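{- Let $\pi$ be a permutation. If the set $\mathcal V(\pi)$ of valid compositions of $\pi$ is nonempty, then $\mathcal V(\pi)$ is a transversal discrete polymatroid.
   Context: A permutation of size $n\ge 1$ is an ordering $\pi=\pi_1\cdots\pi_n$ of a set of $n$ distinct positive integers. A descent of $\pi$ is an index $i\in[n-1]$ with $\pi_i>\pi_{i+1}$. The plot of $\pi$ is the set of points $(i,\pi_i)$, $i\in[n]$. A hook of $\pi$ with southwest endpoint $(i,\pi_i)$ and northeast endpoint $(j,\pi_j)$, where $i<j$ and $\pi_i<\pi_j$, is the union of the vertical segment from $(i,\pi_i)$ to $(i,\pi_j)$ and the horizontal segment from $(i,\pi_j)$ to $(j,\pi_j)$. A point $(m,\pi_m)$ lies directly above (respectively, below) this hook if $i<m<j$ and $\pi_m>\pi_j$ (respectively, $\pi_m<\pi_j$). Let $d_1<\cdots<d_k$ be the descents of $\pi$. A valid hook configuration of $\pi$ is a tuple $\mathcal H=(H_1,\ldots,H_k)$ of hooks of $\pi$ such that: (1) $H_i$ has southwest endpoint $(d_i,\pi_{d_i})$ for each $i$; (2) no point of the plot lies directly above a hook of $\mathcal H$; (3) no two hooks of $\mathcal H$ intersect or overlap, except that the northeast endpoint of one may be the southwest endpoint of another. (If $k=0$, there is exactly one, the empty configuration.) Let $\mathrm{VHC}(\pi)$ be the set of valid hook configurations of $\pi$. Each $\mathcal H\in\mathrm{VHC}(\pi)$ induces a coloring of the $n-k$ points of the plot that are not northeast endpoints of hooks of $\mathcal H$: such a point $(m,\pi_m)$ gets the color of the lowest hook of $\mathcal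 H$ lying above it (i.e. among the hooks of $\mathcal H$ below which it lies, the one whose northeast endpoint has smallest height; a hook is not considered to lie above its own southwest endpoint), and the color of the "sky" if there is no such hook. Let $q_i$ be the number of points with the color of $H_i$ ($1\le i\le k$) and $q_0$ the number with the color of the sky. Then $\mathbf q^{\mathcal H}=(q_0,\ldots,q_k)$ is a composition of $n-k$ into $k+1$ (positive) parts. Set $\mathcal V(\pi)=\{\mathbf q^{\mathcal H}:\mathcal H\in\mathrm{VHC}(\pi)\}\subseteq\mathbb Z_{>0}^{k+1}$. A nonempty set $A\subseteq\mathbb Z^{k+1}$ is M-convex if for all $a,b\in A$ and every $i\in[k+1]$ with $a_i>b_i$ there is $j\in[k+1]$ with $a_j<b_j$ such that $a-e_i+e_j\in A$ and $b+e_i-e_j\in A$, where $e_1,\dots,e_{k+1}$ is the standard basis. A discrete polymatroid is a finite M-convex set contained in $\mathbb Z_{\ge0}^{k+1}$. It is transversal if it has the form $\{e_{i_1}+\cdots+e_{i_\ell}:i_j\in I_j\text{ for all }j\in[\ell]\}$ for some (not necessarily distinct) nonempty subsets $I_1,\ldots,I_\ell$ of $[k+1]$ (every set of this form is known to be a discrete polymatroid). -}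

module Defs where

open import Data.Nat.Base as ℕ using (ℕ; zero; suc; NonZero)
import Data.Nat.Properties as ℕ
open import Data.Integer.Base as ℤ using (ℤ; +_; 0ℤ; 1ℤ)
open import Data.Rational.Base as ℚ using (ℚ)
open import Data.Fin.Base as Fin using (Fin; zero; suc; toℕ)
open import Data.Fin.Properties as Fin using (any?; all?)
open import Data.Fin.Subset as Subset using (Subset)
open import Data.List.Base as List using (List; length; filter; allFin)
import Data.List.Membership.Propositional as List
open import Data.Vec.Base as Vec using (Vec; lookup; tabulate; replicate; zipWith; _[_]≔_)
import Data.Vec.Functional as Vector
open import Data.Product.Base using (Σ; ∃; _×_; _,_)
open import Data.Sum.Base using (_⊎_)
open import Function.Definitions using (Injective)
open import Level using (0ℓ)
open import Relation.Binary.PropositionalEquality.Core using (_≡_; _≢_)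
open import Relation.Nullary using (¬_; Dec; ¬?; _×-dec_; _→-dec_)
open import Relation.Unary using (Pred; Decidable; Satisfiable; _∈_; _≐_)

------------------------------------------------------------------------
-- Permutations

record Permutation (n : ℕ) : Set where
  field
    .{{size≥1}} : NonZero n
    val       : Fin n → ℕ
    positive  : ∀ i → 0 ℕ.< val i
    injective : Injective _≡_ _≡_ val

-- The rational plane stands in for the real one.  Hooks are unions of
-- axis-parallel segments with integral endpoints, so two of them meet in a
-- single given lattice point over ℚ exactly when they do so over ℝ.
Point : Set
Point = ℚ × ℚ

fromℕ : ℕ → ℚ
fromℕ m = + m ℚ./ 1

module _ {n : ℕ} (π : Permutation n) where
  open Permutation π

  -- An element i of Fin n stands for the index toℕ i + 1 of [n].
  abscissa ordinate : Fin n → ℚ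
  abscissa i = fromℕ (suc (toℕ i))
  ordinate i = fromℕ (val i)

  plotPoint : Fin n → Point
  plotPoint i = abscissa i , ordinate i

  IsDescent : Pred (Fin n) 0ℓ
  IsDescent i = ∃ λ j → toℕ j ≡ suc (toℕ i) × val j ℕ.< val i

  isDescent? : Decidable IsDescent
  isDescent? i = any? λ j → (toℕ j ℕ.≟ suc (toℕ i)) ×-dec (val j ℕ.<? val i)

  -- The descents in increasing order (allFin n is increasing).
  descents : List (Fin n)
  descents = filter isDescent? (allFin n)

  #descents : ℕ
  #descents = length descents

  descent : Fin #descents → Fin n
  descent = List.lookup descents

  ----------------------------------------------------------------------
  -- Hooks

  record Hook : Set where
    field
      sw ne : Fin n
      sw<ne : sw Fin.< ne
      rises : val sw ℕ.< val ne

  open Hook public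

  -- The union of the vertical segment and the horizontal segment.
  OnHook : Hook → Pred Point 0ℓ
  OnHook h (x , y) =
    (x ≡ abscissa (sw h) × ordinate (sw h) ℚ.≤ y × y ℚ.≤ ordinate (ne h)) ⊎
    (y ≡ ordinate (ne h) × abscissa (sw h) ℚ.≤ x × x ℚ.≤ abscissa (ne h))

  DirectlyAbove DirectlyBelow : Fin n → Hook → Set
  DirectlyAbove m h = sw h Fin.< m × m Fin.< ne h × val (ne h) ℕ.< val m
  DirectlyBelow m h = sw h Fin.< m × m Fin.< ne h × val m ℕ.< val (ne h)

  directlyBelow? : ∀ m h → Dec (DirectlyBelow m h)
  directlyBelow? m h =
    (sw h Fin.<? m) ×-dec (m Fin.<? ne h) ×-dec (val m ℕ.<? val (ne h))

  record VHC : Set where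
    field
      hook : Fin #descents → Hook
      startsAtDescent : ∀ i → sw (hook i) ≡ descent i
      noneAbove : ∀ i m → ¬ DirectlyAbove m (hook i)
      noCrossing : ∀ i j → i ≢ j → ∀ p → OnHook (hook i) p → OnHook (hook j) p →
        (p ≡ plotPoint (ne (hook i)) × p ≡ plotPoint (sw (hook j))) ⊎
        (p ≡ plotPoint (ne (hook j)) × p ≡ plotPoint (sw (hook i)))

  ----------------------------------------------------------------------
  -- The induced colouring and valid compositions

  module _ (H : VHC) where
    open VHC H

    -- Colour zero is the sky; colour suc i is that of the i-th hook.
    Colour : Set
    Colour = Fin (suc #descents)

    IsNortheastEndpoint : Pred (Fin n) 0ℓ
    IsNortheastEndpoint m = ∃ λ i → ne (hook i) ≡ m

    -- Lowest means smallest height of the northeast endpoint.  A hook lies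
    -- above the points directly below it; never above its own endpoints.
    HasColour : Colour → Pred (Fin n) 0ℓ
    HasColour zero    m = ∀ i → ¬ DirectlyBelow m (hook i)
    HasColour (suc i) m = DirectlyBelow m (hook i) ×
      (∀ j → DirectlyBelow m (hook j) → val (ne (hook i)) ℕ.≤ val (ne (hook j)))

    Coloured : Colour → Pred (Fin n) 0ℓ
    Coloured c m = ¬ IsNortheastEndpoint m × HasColour c m

    isNortheastEndpoint? : Decidable IsNortheastEndpoint
    isNortheastEndpoint? m = any? λ i → ne (hook i) Fin.≟ m

    hasColour? : ∀ c → Decidable (HasColour c)
    hasColour? zero    m = all? λ i → ¬? (directlyBelow? m (hook i))
    hasColour? (suc i) m = directlyBelow? m (hook i) ×-dec
      (all? λ j → directlyBelow? m (hook j) →-dec (val (ne (hook i)) ℕ.≤? val (ne (hook j))))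

    coloured? : ∀ c → Decidable (Coloured c)
    coloured? c m = ¬? (isNortheastEndpoint? m) ×-dec hasColour? c m

    composition : Vec ℤ (suc #descents)
    composition = tabulate λ c → + length (filter (coloured? c) (allFin n))

  -- Components are in the order (q₀, q₁, …, q_k), q₀ being the sky.
  validCompositions : Pred (Vec ℤ (suc #descents)) 0ℓ
  validCompositions q = ∃ λ H → q ≡ composition H

------------------------------------------------------------------------
-- Discrete polymatroids

infixl 6 _⊕_ _⊖_

_⊕_ _⊖_ : ∀ {m} → Vec ℤ m → Vec ℤ m → Vec ℤ m
_⊕_ = zipWith ℤ._+_
_⊖_ = zipWith ℤ._-_

𝟎 : ∀ {m} → Vec ℤ m
𝟎 = replicate _ 0ℤ

e : ∀ {m} → Fin m → Vec ℤ m
e i = 𝟎 [ i ]≔ 1ℤ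

∑ : ∀ {m ℓ} → (Fin ℓ → Vec ℤ m) → Vec ℤ m
∑ = Vector.foldr _⊕_ 𝟎

module _ {m : ℕ} (A : Pred (Vec ℤ m) 0ℓ) where

  record IsMConvex : Set where
    field
      nonempty : Satisfiable A
      exchange : ∀ {a b} → a ∈ A → b ∈ A → ∀ i → lookup b i ℤ.< lookup a i →
        ∃ λ j → lookup a j ℤ.< lookup b j × (a ⊖ e i ⊕ e j) ∈ A × (b ⊕ e i ⊖ e j) ∈ A

  IsFinite : Set
  IsFinite = ∃ λ xs → A ≐ (List._∈ xs)

  record IsDiscretePolymatroid : Set where
    field
      isMConvex   : IsMConvex
      finite      : IsFinite
      nonnegative : ∀ {a} → a ∈ A → ∀ i → 0ℤ ℤ.≤ lookup a i

-- { e_{i_1} + ⋯ + e_{i_ℓ} : i_j ∈ I_j for all j }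
transversalSums : ∀ {m ℓ} → (Fin ℓ → Subset m) → Pred (Vec ℤ m) 0ℓ
transversalSums {m} {ℓ} I x =
  Σ (Fin ℓ → Fin m) λ i → (∀ j → i j Subset.∈ I j) × x ≡ ∑ (λ j → e (i j))

record IsTransversalDiscretePolymatroid {m : ℕ} (A : Pred (Vec ℤ m) 0ℓ) : Set where
  field
    isDiscretePolymatroid : IsDiscretePolymatroid A
    ℓ            : ℕ
    I            : Fin ℓ → Subset m
    I-nonempty   : ∀ j → Subset.Nonempty (I j)
    isTransversal : A ≐ transversalSums I

{-# OPTIONS --safe #-}
module Submission where

-- Let d₁ < … < d_k be the descents.  Valid hook configurations correspond to families of
-- half-open intervals (d_i, r_i] that are laminar and such that π takes its strict maximum
-- on [d_i, r_i] at r_i.  They are closed under pointwise minima, so there is a smallest one,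
-- c, and every laminar family r ≥ c is valid again.  Give each point the index of the
-- innermost interval that contains it, or 0; the i-th part of the composition, increased by
-- one because of r_i itself, is then the number of points of index i.
--
-- For a point p that is none of the c_i, let I_p consist of the indices x such that d_x < p
-- (no condition for x = 0) and i ≤ x whenever d_i < p ≤ c_i.  The valid compositions are the
-- transversal sums of these sets.  Given r, the innermost indices satisfy the conditions
-- defining I_p, and interchanging values makes c_i have index i.  Conversely, an assignment
-- prescribes the length of each interval in terms of those it contains, hence a laminar
-- family, and counting the points of (d_i, c_i] shows that it lies above c.

open import Defs
import Algebra.Construct.NaturalChoice.Min
open import Data.Bool.Base using (true; false; if_then_else_)
open import Data.Fin.Base as Fin using (Fin; zero; suc; toℕ; finToFun; funToFin)
import Data.Fin.Induction as Fin
import Data.Fin.Properties as Fin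
open import Data.Fin.Subset as Subset using (Subset)
import Data.Fin.Subset.Properties as Subset
open import Data.Integer.Base as ℤ using (ℤ)
import Data.Integer.Properties as ℤ
import Data.Integer.Solver
open import Data.List.Base as List using (List; []; _∷_; length; filter; allFin)
import Data.List.Membership.Propositional as List
open import Data.List.Membership.Propositional.Properties
  using (∈-cartesianProductWith⁺; ∈-cartesianProductWith⁻; ∈-map⁺; ∈-map⁻; ∈-filter⁺; ∈-filter⁻; ∈-allFin; ∈-lookup)
import Data.List.Relation.Unary.All as All
open import Data.List.Relation.Unary.AllPairs using (AllPairs; []; _∷_)
import Data.List.Relation.Unary.AllPairs.Properties as AllPairs
open import Data.List.Relation.Unary.Any as Any using (here; there)
open import Data.List.Relation.Unary.Any.Properties using (lookup-index)
open import Data.Nat.Base hiding (_⊓_)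
import Data.Nat.Coprimality as Coprime
open import Data.Nat.Properties hiding (⊓-sel)
open import Data.Nat.Solver using (module +-*-Solver)
open import Data.Product.Base using (∃; _×_; _,_; proj₁; proj₂; map₁; map₂)
open import Data.Rational.Base as ℚ using (ℚ; mkℚ)
import Data.Rational.Properties as ℚ
open import Data.Sum.Base using (_⊎_; inj₁; inj₂)
open import Data.Unit.Base using (⊤; tt)
open import Data.Vec.Base as Vec using (Vec; lookup; tabulate)
open import Data.Vec.Functional using (updateAt)
open import Data.Vec.Functional.Properties using (updateAt-updates; updateAt-minimal)
import Data.Vec.Properties as Vec
open import Function.Base using (_∘_; _$_; const; case_of_)
open import Function.Definitions using (Injective)
open import Induction.WellFounded using (Acc; acc)
open import Level using (Level; 0ℓ)
open import Relation.Binary.Core using (Rel)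
open import Relation.Binary.Definitions using (tri<; tri≈; tri>)
open import Relation.Binary.PropositionalEquality
open import Relation.Nullary using (¬_; Dec; yes; no; does; ¬?; contradiction; _×-dec_; _→-dec_)
open import Relation.Nullary.Decidable using (dec-true; dec-false)
open import Relation.Unary using (Pred; Decidable; _≐_; Satisfiable)

open import Algebra.Properties.CommutativeMonoid.Sum +-0-commutativeMonoid
  using (sum; sum-cong-≗; ∑-distrib-+; ∑-comm; sum-replicate-zero)

private
  variable
    a b : Level
    A B : Set a
    k m n ℓ : ℕ

-- Counting

-- It branches on `does`, as `filter` does, so that in `length-filter-allFin` and `sum-filter` a
-- single `with` reduces both sides.
ι : Dec A → ℕ
ι A? = if does A? then 1 else 0

does-true : (A? : Dec A) → does A? ≡ true → A
does-true (yes x) _ = x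

ι-yes : (A? : Dec A) → A → ι A? ≡ 1
ι-yes A? x = cong (if_then 1 else 0) (dec-true A? x)

ι-no : (A? : Dec A) → ¬ A → ι A? ≡ 0
ι-no A? ¬x = cong (if_then 1 else 0) (dec-false A? ¬x)

ι-mono : (A? : Dec A) (B? : Dec B) → (A → B) → ι A? ≤ ι B?
ι-mono (no _)  _  _ = z≤n
ι-mono (yes x) B? f = ≤-reflexive (sym (ι-yes B? (f x)))

ι-cong : (A? : Dec A) (B? : Dec B) → (A → B) → (B → A) → ι A? ≡ ι B?
ι-cong A? B? f g = ≤-antisym (ι-mono A? B? f) (ι-mono B? A? g)

ι-¬ : (A? : Dec A) → ι A? + ι (¬? A?) ≡ 1
ι-¬ (yes _) = refl
ι-¬ (no _)  = refl

ι-*-cong : (A? : Dec A) {x y : ℕ} → (A → x ≡ y) → ι A? * x ≡ ι A? * y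
ι-*-cong (yes z) eq = cong (_+ 0) (eq z)
ι-*-cong (no _)  _  = refl

# : {P : Pred (Fin n) a} → Decidable P → ℕ
# P? = sum (λ p → ι (P? p))

sum-mono : {f g : Fin n → ℕ} → (∀ p → f p ≤ g p) → sum f ≤ sum g
sum-mono {zero}  f≤g = z≤n
sum-mono {suc n} f≤g = +-mono-≤ (f≤g zero) (sum-mono (f≤g ∘ suc))

sum-zero : {f : Fin n → ℕ} → (∀ p → f p ≡ 0) → sum f ≡ 0
sum-zero {n} f≡0 = trans (sum-cong-≗ f≡0) (sum-replicate-zero n)

sum-δ : (p : Fin n) (f : Fin n → ℕ) → sum (λ q → ι (q Fin.≟ p) * f q) ≡ f p
sum-δ {suc n} zero f = begin
  f zero + 0 + sum {n} (λ _ → 0) ≡⟨ cong₂ _+_ (+-identityʳ (f zero)) (sum-replicate-zero n) ⟩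
  f zero + 0                    ≡⟨ +-identityʳ _ ⟩
  f zero                        ∎
  where open ≡-Reasoning
sum-δ (suc p) f = trans (sum-cong-≗ λ q → cong (_* f (suc q))
  (ι-cong (suc q Fin.≟ suc p) (q Fin.≟ p) Fin.suc-injective (cong suc)))
  (sum-δ p (f ∘ suc))

sum-*ˡ : (x : ℕ) (f : Fin n → ℕ) → x * sum f ≡ sum (λ p → x * f p)
sum-*ˡ {zero}  x f = *-zeroʳ x
sum-*ˡ {suc n} x f = trans (*-distribˡ-+ x (f zero) _) (cong (x * f zero +_) (sum-*ˡ x (f ∘ suc)))

sum-*ʳ : (f : Fin n → ℕ) (x : ℕ) → sum f * x ≡ sum (λ p → f p * x)
sum-*ʳ f x = trans (*-comm (sum f) x)
  (trans (sum-*ˡ x f) (sum-cong-≗ λ p → *-comm x (f p)))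

#-cong : {P : Pred (Fin n) a} {Q : Pred (Fin n) b} (P? : Decidable P) (Q? : Decidable Q) →
         (∀ p → P p → Q p) → (∀ p → Q p → P p) → # P? ≡ # Q?
#-cong P? Q? P⊆Q Q⊆P = sum-cong-≗ λ p → ι-cong (P? p) (Q? p) (P⊆Q p) (Q⊆P p)

#-mono : {P : Pred (Fin n) a} {Q : Pred (Fin n) b} (P? : Decidable P) (Q? : Decidable Q) →
         (∀ p → P p → Q p) → # P? ≤ # Q?
#-mono P? Q? P⊆Q = sum-mono λ p → ι-mono (P? p) (Q? p) (P⊆Q p)

#-singleton : (p : Fin n) → # (Fin._≟ p) ≡ 1
#-singleton p = trans (sum-cong-≗ λ q → sym (*-identityʳ (ι (q Fin.≟ p)))) (sum-δ p (const 1))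

#-single : {P : Pred (Fin n) a} (P? : Decidable P) (p : Fin n) → P p →
           (∀ q → P q → q ≡ p) → # P? ≡ 1
#-single P? p Pp unique = trans
  (#-cong P? (Fin._≟ p) unique λ { _ refl → Pp }) (#-singleton p)

#-all : sum {n} (const 1) ≡ n
#-all {zero}  = refl
#-all {suc n} = cong suc #-all

upto? : (p : Fin n) → Decidable {A = Fin n} (Fin._≤ p)
upto? p q = q Fin.≤? p

beyond? : (p : Fin n) → Decidable {A = Fin n} (p Fin.<_)
beyond? p q = p Fin.<? q

#-upto : (p : Fin n) → # (upto? p) ≡ suc (toℕ p)
#-upto {suc n} zero    = cong suc (sum-zero {n} λ _ → refl)
#-upto {suc n} (suc p) = cong suc (trans
  (sum-cong-≗ λ q → ι-cong (upto? (suc p) (suc q)) (upto? p q) s≤s⁻¹ s≤s) (#-upto p))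

#-beyond : (p : Fin n) → # (beyond? p) + suc (toℕ p) ≡ n
#-beyond {n} p = begin
  # (beyond? p) + suc (toℕ p)        ≡⟨ cong (# (beyond? p) +_) (#-upto p) ⟨
  # (beyond? p) + # (upto? p)       ≡⟨ ∑-distrib-+ _ (λ q → ι (upto? p q)) ⟨
  sum (λ q → ι (beyond? p q) + ι (upto? p q)) ≡⟨ sum-cong-≗ (λ q → trans
    (cong (ι (beyond? p q) +_) (ι-cong (upto? p q) (¬? (beyond? p q)) ≤⇒≯ ≮⇒≥))
    (ι-¬ (beyond? p q))) ⟩
  sum {n} (const 1)                       ≡⟨ #-all ⟩
  n ∎
  where open ≡-Reasoning

between? : (p q : Fin n) → Decidable {A = Fin n} (λ x → p Fin.< x × x Fin.≤ q)
between? p q x = (beyond? p x) ×-dec (upto? q x)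

#-between : (p q : Fin n) → p Fin.≤ q → # (between? p q) + toℕ p ≡ toℕ q
#-between p q p≤q = suc-injective $ begin
  suc (# (between? p q) + toℕ p)            ≡⟨ +-suc _ (toℕ p) ⟨
  # (between? p q) + suc (toℕ p)            ≡⟨ cong (# (between? p q) +_) (#-upto p) ⟨
  # (between? p q) + # (upto? p)          ≡⟨ ∑-distrib-+ _ (λ x → ι (upto? p x)) ⟨
  sum (λ x → ι (between? p q x) + ι (upto? p x)) ≡⟨ sum-cong-≗ split ⟩
  # (upto? q)                             ≡⟨ #-upto q ⟩
  suc (toℕ q) ∎
  where
  open ≡-Reasoning
  split : ∀ x → ι (between? p q x) + ι (upto? p x) ≡ ι (upto? q x)
  split x with upto? p x
  ... | yes x≤p = trans
    (cong₂ _+_ (ι-no (between? p q x) λ (p<x , _) → <⇒≱ p<x x≤p) (ι-yes (upto? p x) x≤p))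
    (sym (ι-yes (upto? q x) (≤-trans x≤p p≤q)))
  ... | no x≰p = trans
    (cong₂ _+_ (ι-cong (between? p q x) (upto? q x) proj₂ (λ x≤q → ≰⇒> x≰p , x≤q))
               (ι-no (upto? p x) x≰p))
    (+-identityʳ _)

length-filter-allFin : {P : Pred (Fin n) a} (P? : Decidable P) →
                       length (filter P? (allFin n)) ≡ # P?
length-filter-allFin {n} P? = go (λ p → p) P?
  where
  -- `allFin n` tabulates the identity, but its tail tabulates `suc`; the induction therefore needs
  -- an arbitrary `f`.
  go : ∀ {a b m} {C : Set b} {P : Pred C a} (f : Fin m → C) (P? : Decidable P) →
       length (filter P? (List.tabulate f)) ≡ # (λ i → P? (f i))
  go {m = zero}  f P? = refl
  go {m = suc m} f P? with does (P? (f zero))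
  ... | true  = cong suc (go (f ∘ suc) P?)
  ... | false = go (f ∘ suc) P?

sum-filter : {P : Pred (Fin n) a} (P? : Decidable P) (f : Fin n → ℕ) →
  sum (λ j → f (List.lookup (filter P? (allFin n)) j)) ≡ sum (λ p → ι (P? p) * f p)
sum-filter P? f = go (λ p → p) P? f
  where
  go : ∀ {a b m} {C : Set b} {P : Pred C a} (g : Fin m → C) (P? : Decidable P) (f : C → ℕ) →
       sum (λ j → f (List.lookup (filter P? (List.tabulate g)) j)) ≡ sum (λ i → ι (P? (g i)) * f (g i))
  go {m = zero}  g P? f = refl
  go {m = suc m} g P? f with does (P? (g zero))
  ... | true  = cong₂ _+_ (sym (+-identityʳ _)) (go (g ∘ suc) P? f)
  ... | false = go (g ∘ suc) P? f

-- The image of an injection and its complement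

module _ (c : Fin m → Fin n) where

  InImage : Pred (Fin n) _
  InImage p = ∃ λ i → c i ≡ p

  inImage? : Decidable InImage
  inImage? p = Fin.any? λ i → c i Fin.≟ p

  complement : List (Fin n)
  complement = filter (λ p → ¬? (inImage? p)) (allFin n)

  -- By injectivity the indicator of the image is the sum of the indicators of the points `c i`;
  -- then the two summations are interchanged.
  sum-image : Injective _≡_ _≡_ c → (f : Fin n → ℕ) →
              sum (λ p → ι (inImage? p) * f p) ≡ sum (f ∘ c)
  sum-image inj f = begin
    sum (λ p → ι (inImage? p) * f p)               ≡⟨ sum-cong-≗ (λ p → cong (_* f p) (indicator p)) ⟩
    sum (λ p → sum (λ i → ι (p Fin.≟ c i)) * f p)  ≡⟨ sum-cong-≗ (λ p → sum-*ʳ (λ i → ι (p Fin.≟ c i)) (f p)) ⟩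
    sum (λ p → sum (λ i → ι (p Fin.≟ c i) * f p))  ≡⟨ ∑-comm (λ p i → ι (p Fin.≟ c i) * f p) ⟩
    sum (λ i → sum (λ p → ι (p Fin.≟ c i) * f p))  ≡⟨ sum-cong-≗ (λ i → sum-δ (c i) f) ⟩
    sum (f ∘ c)                                    ∎
    where
    open ≡-Reasoning
    indicator : ∀ p → ι (inImage? p) ≡ sum (λ i → ι (p Fin.≟ c i))
    indicator p with inImage? p
    ... | yes (i , refl) = sym (#-single (λ j → c i Fin.≟ c j) i refl (λ j e → inj (sym e)))
    ... | no ∉ = sym (sum-zero λ i → ι-no (p Fin.≟ c i) λ e → ∉ (i , sym e))

  sum-split : Injective _≡_ _≡_ c → (f : Fin n → ℕ) →
              sum f ≡ sum (λ j → f (List.lookup complement j)) + sum (f ∘ c)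
  sum-split inj f = begin
    sum f
      ≡⟨ sum-cong-≗ (λ p → trans (sym (+-identityʳ _)) (cong (_* f p)
           (trans (sym (ι-¬ (inImage? p))) (+-comm (ι (inImage? p)) _)))) ⟩
    sum (λ p → (ι (¬? (inImage? p)) + ι (inImage? p)) * f p)
      ≡⟨ sum-cong-≗ (λ p → *-distribʳ-+ (f p) (ι (¬? (inImage? p))) _) ⟩
    sum (λ p → ι (¬? (inImage? p)) * f p + ι (inImage? p) * f p)
      ≡⟨ ∑-distrib-+ _ (λ p → ι (inImage? p) * f p) ⟩
    sum (λ p → ι (¬? (inImage? p)) * f p) + sum (λ p → ι (inImage? p) * f p)
      ≡⟨ cong₂ _+_ (sym (sum-filter (λ p → ¬? (inImage? p)) f)) (sum-image inj f) ⟩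
    sum (λ j → f (List.lookup complement j)) + sum (f ∘ c) ∎
    where open ≡-Reasoning

-- Double counting of the pairs `(p , x)` with `g p ≡ x`, each taken with weight `f x`.
sum-fibres : ∀ {k} (g : Fin n → Fin k) (f : Fin k → ℕ) →
             sum (f ∘ g) ≡ sum (λ x → f x * # (λ p → g p Fin.≟ x))
sum-fibres g f = begin
  sum (f ∘ g)                                        ≡⟨ sum-cong-≗ (λ p → sum-δ (g p) f) ⟨
  sum (λ p → sum (λ x → ι (x Fin.≟ g p) * f x))      ≡⟨ ∑-comm (λ p x → ι (x Fin.≟ g p) * f x) ⟩
  sum (λ x → sum (λ p → ι (x Fin.≟ g p) * f x))      ≡⟨ sum-cong-≗ (λ x → sum-cong-≗ λ p → trans
    (*-comm (ι (x Fin.≟ g p)) (f x)) (cong (f x *_) (ι-cong (x Fin.≟ g p) (g p Fin.≟ x) sym sym))) ⟩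
  sum (λ x → sum (λ p → f x * ι (g p Fin.≟ x)))      ≡⟨ sum-cong-≗ (λ x → sum-*ˡ (f x) (λ p → ι (g p Fin.≟ x))) ⟨
  sum (λ x → f x * # (λ p → g p Fin.≟ x))            ∎
  where open ≡-Reasoning

-- Only the term at `p` changes; adding the old and the new term on opposite sides avoids truncated
-- subtraction. The dependence of `f` on the position covers the distance between `s` and `t` in
-- `exchange-path`.
sum-updateAt : (s : Fin n → A) (p : Fin n) (x : A) (f : Fin n → A → ℕ) →
  sum (λ q → f q (updateAt s p (const x) q)) + f p (s p) ≡ sum (λ q → f q (s q)) + f p x
sum-updateAt {suc n} s zero x f =
  solve 3 (λ u v w → u :+ v :+ w := w :+ v :+ u) refl
    (f zero x) (sum (λ q → f (suc q) (s (suc q)))) (f zero (s zero))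
  where open +-*-Solver
sum-updateAt {suc n} s (suc p) x f = trans (+-assoc (f zero (s zero)) _ _)
  (trans (cong (f zero (s zero) +_) (sum-updateAt (s ∘ suc) p x (f ∘ suc)))
         (sym (+-assoc (f zero (s zero)) _ _)))

-- Exchange for transversal sums

count : (Fin ℓ → Fin m) → Fin m → ℕ
count s x = # (λ p → s p Fin.≟ x)

count-updateAt : (s : Fin ℓ → Fin m) (p : Fin ℓ) (x y : Fin m) →
  count (updateAt s p (const x)) y + ι (s p Fin.≟ y) ≡ count s y + ι (x Fin.≟ y)
count-updateAt s p x y = sum-updateAt s p x (λ _ z → ι (z Fin.≟ y))

vec-ext : ∀ {a} {A : Set a} {u v : Vec A m} → (∀ x → lookup u x ≡ lookup v x) → u ≡ v
vec-ext {u = u} {v} eq = trans (sym (Vec.tabulate∘lookup u))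
  (trans (Vec.tabulate-cong eq) (Vec.tabulate∘lookup v))

lookup-e : (i x : Fin m) → lookup (e i) x ≡ ℤ.+ ι (i Fin.≟ x)
lookup-e i x with i Fin.≟ x
... | yes refl = Vec.lookup∘update i 𝟎 (ℤ.+ 1)
... | no i≢x   = trans (Vec.lookup∘update′ (i≢x ∘ sym) 𝟎 (ℤ.+ 1)) (Vec.lookup-replicate x (ℤ.+ 0))

lookup-∑e : (s : Fin ℓ → Fin m) (x : Fin m) → lookup (∑ (λ j → e (s j))) x ≡ ℤ.+ count s x
lookup-∑e {zero}  s x = Vec.lookup-replicate x (ℤ.+ 0)
lookup-∑e {suc ℓ} s x = begin
  lookup (e (s zero) ⊕ ∑ (λ j → e (s (suc j)))) x          ≡⟨ Vec.lookup-zipWith ℤ._+_ x (e (s zero)) _ ⟩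
  lookup (e (s zero)) x ℤ.+ lookup (∑ (λ j → e (s (suc j)))) x ≡⟨ cong₂ ℤ._+_ (lookup-e (s zero) x) (lookup-∑e (s ∘ suc) x) ⟩
  ℤ.+ ι (s zero Fin.≟ x) ℤ.+ ℤ.+ count (s ∘ suc) x             ≡⟨ ℤ.pos-+ (ι (s zero Fin.≟ x)) _ ⟨
  ℤ.+ count s x                                              ∎
  where open ≡-Reasoning

lookup-⊖⊕ : (a : Vec ℤ m) (i j x : Fin m) →
  lookup (a ⊖ e i ⊕ e j) x ≡ lookup a x ℤ.- ℤ.+ ι (i Fin.≟ x) ℤ.+ ℤ.+ ι (j Fin.≟ x)
lookup-⊖⊕ a i j x = trans (Vec.lookup-zipWith ℤ._+_ x (a ⊖ e i) (e j))
  (cong₂ ℤ._+_ (trans (Vec.lookup-zipWith ℤ._-_ x a (e i)) (cong (ℤ._-_ (lookup a x)) (lookup-e i x)))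
               (lookup-e j x))

lookup-⊕⊖ : (a : Vec ℤ m) (i j x : Fin m) →
  lookup (a ⊕ e i ⊖ e j) x ≡ lookup a x ℤ.+ ℤ.+ ι (i Fin.≟ x) ℤ.- ℤ.+ ι (j Fin.≟ x)
lookup-⊕⊖ a i j x = trans (Vec.lookup-zipWith ℤ._-_ x (a ⊕ e i) (e j))
  (cong₂ ℤ._-_ (trans (Vec.lookup-zipWith ℤ._+_ x a (e i)) (cong (ℤ._+_ (lookup a x)) (lookup-e i x)))
               (lookup-e j x))

-- The exchange property for choice functions. Keeping or swapping the two values at each position
-- preserves membership in every `I p` as well as the total counts, so that `count-t` follows from
-- `count-s`.
record Exchange (s t : Fin ℓ → Fin m) (i : Fin m) : Set where
  field
    s′ t′   : Fin ℓ → Fin m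
    swapped : ∀ p → (s′ p ≡ s p × t′ p ≡ t p) ⊎ (s′ p ≡ t p × t′ p ≡ s p)
    j       : Fin m
    gains   : count s j < count t j
    count-s : ∀ x → count s′ x + ι (i Fin.≟ x) ≡ count s x + ι (j Fin.≟ x)

  count-total : ∀ x → count s′ x + count t′ x ≡ count s x + count t x
  count-total x = begin
    count s′ x + count t′ x                            ≡⟨ ∑-distrib-+ _ (λ p → ι (t′ p Fin.≟ x)) ⟨
    sum (λ p → ι (s′ p Fin.≟ x) + ι (t′ p Fin.≟ x))    ≡⟨ sum-cong-≗ pointwise ⟩
    sum (λ p → ι (s p Fin.≟ x) + ι (t p Fin.≟ x))      ≡⟨ ∑-distrib-+ _ (λ p → ι (t p Fin.≟ x)) ⟩
    count s x + count t x                              ∎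
    where
    open ≡-Reasoning
    pointwise : ∀ p → ι (s′ p Fin.≟ x) + ι (t′ p Fin.≟ x) ≡ ι (s p Fin.≟ x) + ι (t p Fin.≟ x)
    pointwise p with swapped p
    ... | inj₁ (e₁ , e₂) rewrite e₁ | e₂ = refl
    ... | inj₂ (e₁ , e₂) rewrite e₁ | e₂ = +-comm (ι (t p Fin.≟ x)) _

  count-t : ∀ x → count t′ x + ι (j Fin.≟ x) ≡ count t x + ι (i Fin.≟ x)
  count-t x = +-cancelˡ-≡ (count s′ x) _ _ $ begin
    count s′ x + (count t′ x + δj)     ≡⟨ +-assoc (count s′ x) _ _ ⟨
    count s′ x + count t′ x + δj       ≡⟨ cong (_+ δj) (count-total x) ⟩
    count s x + count t x + δj         ≡⟨ solve 3 (λ a b c → a :+ b :+ c := a :+ c :+ b) refl (count s x) _ δj ⟩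
    count s x + δj + count t x         ≡⟨ cong (_+ count t x) (count-s x) ⟨
    count s′ x + δi + count t x        ≡⟨ solve 3 (λ a b c → a :+ b :+ c := a :+ (c :+ b)) refl (count s′ x) δi _ ⟩
    count s′ x + (count t x + δi)      ∎
    where
    open ≡-Reasoning
    open +-*-Solver
    δi = ι (i Fin.≟ x)
    δj = ι (j Fin.≟ x)

-- Regard the positions p as edges s p → t p of a multigraph: out-degree exceeds
-- in-degree at i, so following edges from i leads to some j where in-degree exceeds
-- out-degree, and s and t are swapped along that path.  An edge that has been
-- followed is turned into a loop, which decreases the distance between s and t.
exchange-path : ∀ d (s t : Fin ℓ → Fin m) i → # (λ p → ¬? (s p Fin.≟ t p)) < d →
                count t i < count s i → Exchange s t i
exchange-path (suc d) s t i dist<d t<s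
  with Fin.any? (λ p → (s p Fin.≟ i) ×-dec ¬? (t p Fin.≟ i))
-- If all edges out of `i` are loops, each of them also enters `i`, against the excess of the
-- out-degree.
... | no ∄ = contradiction t<s (≤⇒≯ (#-mono (λ p → s p Fin.≟ i) (λ p → t p Fin.≟ i) loops))
  where
  loops : ∀ p → s p ≡ i → t p ≡ i
  loops p sp≡i with t p Fin.≟ i
  ... | yes tp≡i = tp≡i
  ... | no  tp≢i = contradiction (p , sp≡i , tp≢i) ∄
... | yes (p , refl , tp≢sp) = result
  where
  x = t p

  s₁ : Fin _ → Fin _
  s₁ = updateAt s p (const x)

  count-s₁ : ∀ y → count s₁ y + ι (s p Fin.≟ y) ≡ count s y + ι (x Fin.≟ y)
  count-s₁ = count-updateAt s p x

  s₁p≡x : s₁ p ≡ x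
  s₁p≡x = updateAt-updates p s

  closer : # (λ q → ¬? (s₁ q Fin.≟ t q)) < d
  closer = <-≤-trans (≤-reflexive (begin
    suc (# (λ q → ¬? (s₁ q Fin.≟ t q)))                          ≡⟨ +-comm 1 _ ⟩
    # (λ q → ¬? (s₁ q Fin.≟ t q)) + 1                            ≡⟨ cong (# (λ q → ¬? (s₁ q Fin.≟ t q)) +_)
                                                                     (ι-yes (¬? (s p Fin.≟ t p)) (tp≢sp ∘ sym)) ⟨
    # (λ q → ¬? (s₁ q Fin.≟ t q)) + ι (¬? (s p Fin.≟ t p))        ≡⟨ sum-updateAt s p x (λ q z → ι (¬? (z Fin.≟ t q))) ⟩
    # (λ q → ¬? (s q Fin.≟ t q)) + ι (¬? (x Fin.≟ t p))           ≡⟨ cong (# (λ q → ¬? (s q Fin.≟ t q)) +_)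
                                                                     (ι-no (¬? (x Fin.≟ t p)) (λ ≢ → ≢ refl)) ⟩
    # (λ q → ¬? (s q Fin.≟ t q)) + 0                             ≡⟨ +-identityʳ _ ⟩
    # (λ q → ¬? (s q Fin.≟ t q))                                 ∎)) (s≤s⁻¹ dist<d)
    where open ≡-Reasoning

  result : Exchange s t (s p)
  result with count s x <? count t x
  ... | yes s<t = record
    { s′ = s₁ ; t′ = updateAt t p (const (s p))
    ; swapped = swap
    ; j = x ; gains = s<t ; count-s = count-s₁ }
    where
    swap : ∀ q → (s₁ q ≡ s q × updateAt t p (const (s p)) q ≡ t q) ⊎
                 (s₁ q ≡ t q × updateAt t p (const (s p)) q ≡ s q)
    swap q with q Fin.≟ p
    ... | yes refl = inj₂ (s₁p≡x , updateAt-updates p t)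
    ... | no q≢p   = inj₁ (updateAt-minimal q p s q≢p , updateAt-minimal q p t q≢p)
  -- The path goes on from `x`: the edge `p`, now a loop at `x`, adds one to the out-degree there,
  -- which therefore exceeds the in-degree.
  ... | no s≮t = record
    -- Swapping the loop leaves `x` on both sides at `p`; replacing the second `x` by `s p` turns
    -- this into the swap of the original edge.
    { s′ = E.s′ ; t′ = updateAt E.t′ p (const (s p))
    ; swapped = swap
    ; j = E.j
    ; gains = subst (_< count t E.j) (sym same) E.gains
    ; count-s = counts }
    where
    t<s₁ : count t x < count s₁ x
    t<s₁ = ≤-<-trans (≮⇒≥ s≮t) (≤-reflexive (begin
      suc (count s x)                        ≡⟨ +-comm 1 _ ⟩
      count s x + 1                          ≡⟨ cong (count s x +_) (ι-yes (x Fin.≟ x) refl) ⟨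
      count s x + ι (x Fin.≟ x)              ≡⟨ count-s₁ x ⟨
      count s₁ x + ι (s p Fin.≟ x)           ≡⟨ cong (count s₁ x +_) (ι-no (s p Fin.≟ x) (tp≢sp ∘ sym)) ⟩
      count s₁ x + 0                         ≡⟨ +-identityʳ _ ⟩
      count s₁ x                             ∎))
      where open ≡-Reasoning
    module E = Exchange (exchange-path d s₁ t x closer t<s₁)

    E-at-p : E.s′ p ≡ x
    E-at-p with E.swapped p
    ... | inj₁ (e₁ , _) = trans e₁ s₁p≡x
    ... | inj₂ (e₁ , _) = e₁

    t′p≡x : E.t′ p ≡ x
    t′p≡x with E.swapped p
    ... | inj₁ (_ , e₂) = e₂
    ... | inj₂ (_ , e₂) = trans e₂ s₁p≡x

    swap : ∀ q → (E.s′ q ≡ s q × updateAt E.t′ p (const (s p)) q ≡ t q) ⊎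
                 (E.s′ q ≡ t q × updateAt E.t′ p (const (s p)) q ≡ s q)
    swap q with q Fin.≟ p
    ... | yes refl = inj₂ (E-at-p , updateAt-updates p E.t′)
    ... | no q≢p with E.swapped q | updateAt-minimal q p {const x} s q≢p | updateAt-minimal q p {const (s p)} E.t′ q≢p
    ...   | inj₁ (e₁ , e₂) | e₃ | e₄ = inj₁ (trans e₁ e₃ , trans e₄ e₂)
    ...   | inj₂ (e₁ , e₂) | e₃ | e₄ = inj₂ (e₁ , trans e₄ (trans e₂ e₃))

    counts : ∀ y → count E.s′ y + ι (s p Fin.≟ y) ≡ count s y + ι (E.j Fin.≟ y)
    counts y = +-cancelʳ-≡ (ι (x Fin.≟ y)) _ _ $ begin
      count E.s′ y + δi + δx   ≡⟨ xyz∙ (count E.s′ y) δi δx ⟩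
      count E.s′ y + δx + δi   ≡⟨ cong (_+ δi) (E.count-s y) ⟩
      count s₁ y + δj + δi     ≡⟨ xyz∙ (count s₁ y) δj δi ⟩
      count s₁ y + δi + δj     ≡⟨ cong (_+ δj) (count-s₁ y) ⟩
      count s y + δx + δj      ≡⟨ xyz∙ (count s y) δx δj ⟩
      count s y + δj + δx      ∎
      where
      open ≡-Reasoning
      xyz∙ : ∀ a b c → a + b + c ≡ a + c + b
      xyz∙ = solve 3 (λ a b c → a :+ b :+ c := a :+ c :+ b) refl where open +-*-Solver
      δi = ι (s p Fin.≟ y)
      δj = ι (E.j Fin.≟ y)
      δx = ι (x Fin.≟ y)

    -- The counts of `s` and `s₁` can differ only at `x` and `s p`. Neither of these is `E.j`,
    -- because there `count s₁` is at least `count t`; so `E.gains` carries over to `s`.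
    j≢x : E.j ≢ x
    j≢x j≡x = <-asym t<s₁ (subst (λ y → count s₁ y < count t y) j≡x E.gains)

    same′ : count s₁ E.j + ι (s p Fin.≟ E.j) ≡ count s E.j
    same′ = trans (count-s₁ E.j) (trans (cong (count s E.j +_) (ι-no (x Fin.≟ E.j) (j≢x ∘ sym))) (+-identityʳ _))

    j≢sp : s p ≢ E.j
    j≢sp sp≡j = <⇒≱ (subst (λ y → count t y < count s y) sp≡j t<s)
      (subst (_≤ count t E.j) (trans (+-comm 1 _)
         (trans (cong (count s₁ E.j +_) (sym (ι-yes (s p Fin.≟ E.j) sp≡j))) same′)) E.gains)

    same : count s E.j ≡ count s₁ E.j
    same = trans (sym same′) (trans (cong (count s₁ E.j +_) (ι-no (s p Fin.≟ E.j) j≢sp)) (+-identityʳ _))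

module _ (I : Fin ℓ → Subset m) where

  transversalSums-exchange : ∀ {a b} → transversalSums I a → transversalSums I b → ∀ i →
    lookup b i ℤ.< lookup a i →
    ∃ λ j → lookup a j ℤ.< lookup b j × transversalSums I (a ⊖ e i ⊕ e j) × transversalSums I (b ⊕ e i ⊖ e j)
  transversalSums-exchange {a} {b} (s , s∈I , refl) (t , t∈I , refl) i b<a =
    E.j , subst₂ ℤ._<_ (sym (lookup-∑e s E.j)) (sym (lookup-∑e t E.j)) (ℤ.+<+ E.gains)
    , (E.s′ , s′∈I , vec-ext (λ x → trans (lookup-⊖⊕ (∑ (λ j → e (s j))) i E.j x)
        (trans (cong (λ z → z ℤ.- ℤ.+ ι (i Fin.≟ x) ℤ.+ ℤ.+ ι (E.j Fin.≟ x)) (lookup-∑e s x))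
        (trans (shift⁻ (count E.s′ x) _ (count s x) _ (E.count-s x)) (sym (lookup-∑e E.s′ x))))))
    , (E.t′ , t′∈I , vec-ext (λ x → trans (lookup-⊕⊖ (∑ (λ j → e (t j))) i E.j x)
        (trans (cong (λ z → z ℤ.+ ℤ.+ ι (i Fin.≟ x) ℤ.- ℤ.+ ι (E.j Fin.≟ x)) (lookup-∑e t x))
        (trans (shift⁺ (count E.t′ x) _ (count t x) _ (E.count-t x)) (sym (lookup-∑e E.t′ x))))))
    where
    module E = Exchange (exchange-path _ s t i ≤-refl
      (ℤ.drop‿+<+ (subst₂ ℤ._<_ (lookup-∑e t i) (lookup-∑e s i) b<a)))

    s′∈I : ∀ p → E.s′ p Subset.∈ I p
    s′∈I p with E.swapped p
    ... | inj₁ (e₁ , _) rewrite e₁ = s∈I p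
    ... | inj₂ (e₁ , _) rewrite e₁ = t∈I p

    t′∈I : ∀ p → E.t′ p Subset.∈ I p
    t′∈I p with E.swapped p
    ... | inj₁ (_ , e₂) rewrite e₂ = t∈I p
    ... | inj₂ (_ , e₂) rewrite e₂ = s∈I p

    cancel : ∀ u v → u ℤ.+ v ℤ.- v ≡ u
    cancel = solve 2 (λ u v → u :+ v :- v := u) refl
      where open Data.Integer.Solver.+-*-Solver

    shift⁺ : ∀ u v w z → u + v ≡ w + z → ℤ.+ w ℤ.+ ℤ.+ z ℤ.- ℤ.+ v ≡ ℤ.+ u
    shift⁺ u v w z eq = trans (cong (ℤ._- (ℤ.+ v)) (trans (sym (ℤ.pos-+ w z))
      (trans (cong ℤ.+_ (sym eq)) (ℤ.pos-+ u v)))) (cancel (ℤ.+ u) (ℤ.+ v))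

    shift⁻ : ∀ u v w z → u + v ≡ w + z → ℤ.+ w ℤ.- ℤ.+ v ℤ.+ ℤ.+ z ≡ ℤ.+ u
    shift⁻ u v w z eq = trans (comm (ℤ.+ w) (ℤ.+ v) (ℤ.+ z)) (shift⁺ u v w z eq)
      where
      comm : ∀ a b c → a ℤ.- b ℤ.+ c ≡ a ℤ.+ c ℤ.- b
      comm = solve 3 (λ a b c → a :- b :+ c := a :+ c :- b) refl
        where open Data.Integer.Solver.+-*-Solver

-- Finiteness of transversal sums

transversalSums-finite : (I : Fin ℓ → Subset m) → IsFinite (transversalSums I)
transversalSums-finite {zero} I = 𝟎 ∷ [] , (λ { (_ , _ , refl) → here refl })
  , λ { (here refl) → (λ ()) , (λ ()) , refl }
transversalSums-finite {suc ℓ} I with transversalSums-finite (I ∘ suc)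
... | xs , ⊆xs , xs⊆ = List.cartesianProductWith _⊕_ es xs , to , from
  where
  es = List.map e (filter (Subset._∈? I zero) (allFin _))
  to : ∀ {q} → transversalSums I q → q List.∈ List.cartesianProductWith _⊕_ es xs
  to (s , s∈I , refl) = ∈-cartesianProductWith⁺ _⊕_
    (∈-map⁺ e (∈-filter⁺ (Subset._∈? I zero) (∈-allFin (s zero)) (s∈I zero)))
    (⊆xs (s ∘ suc , s∈I ∘ suc , refl))
  from : ∀ {q} → q List.∈ List.cartesianProductWith _⊕_ es xs → transversalSums I q
  from q∈ with ∈-cartesianProductWith⁻ _⊕_ es xs q∈
  ... | _ , _ , e∈ , r∈ , refl with ∈-map⁻ e e∈ | xs⊆ r∈
  ... | i , i∈ , refl | s , s∈I , refl = (λ { zero → i ; (suc j) → s j })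
    , (λ { zero → proj₂ (∈-filter⁻ (Subset._∈? I zero) {xs = allFin _} i∈) ; (suc j) → s∈I j }) , refl

-- `suc` colours each right end by its own interval. Its count, one for a hook and zero for the sky,
-- is the difference between the number of points of a given index and the part of the composition.
count-suc : (j : Fin k) → count suc (suc j) ≡ 1
count-suc j = #-single (λ i → suc i Fin.≟ suc j) j refl λ _ → Fin.suc-injective

-- Extremal elements of finite ordinals

least : {P : Pred (Fin n) a} → Decidable P → ∃ P → ∃ λ p → P p × ∀ q → P q → p Fin.≤ q
least {suc n} P? (p , Pp) with P? zero
... | yes P0 = zero , P0 , λ _ _ → z≤n
least {suc n} P? (zero , P0)  | no ¬P0 = contradiction P0 ¬P0
least {suc n} P? (suc p , Pp) | no ¬P0 with least (P? ∘ suc) (p , Pp)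
... | q , Pq , q≤ = suc q , Pq , λ
  { zero P0 → contradiction P0 ¬P0 ; (suc x) Px → s≤s (q≤ x Px) }

-- Zero stands for the absence of such an element and `suc i` for `i`, in agreement with the
-- numbering of colours, where zero is the sky.
last : {P : Pred (Fin k) a} → Decidable P → Fin (suc k)
last {zero}  P? = zero
last {suc k} P? with last (P? ∘ suc) | P? zero
... | suc i | _     = suc (suc i)
... | zero  | yes _ = suc zero
... | zero  | no _  = zero

-- The strict inequality says two things at once: the result is not zero, and it is `suc j` for some
-- `j` with `i ≤ j`.
last-upper : {P : Pred (Fin k) a} (P? : Decidable P) → ∀ i → P i → toℕ i < toℕ (last P?)
last-upper {suc k} P? i Pi with last (P? ∘ suc) in eq | P? zero
last-upper P? zero    P0 | suc j | _      = s≤s z≤n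
last-upper P? (suc i) Pi | suc j | _      = s≤s (subst (λ x → toℕ i < toℕ x) eq (last-upper (P? ∘ suc) i Pi))
last-upper P? zero    P0 | zero  | yes _  = s≤s z≤n
last-upper P? zero    P0 | zero  | no ¬P0 = contradiction P0 ¬P0
last-upper P? (suc i) Pi | zero  | _      with () ← subst (λ x → toℕ i < toℕ x) eq (last-upper (P? ∘ suc) i Pi)

last-satisfies : {P : Pred (Fin k) a} (P? : Decidable P) → ∀ j → last P? ≡ suc j → P j
last-satisfies {suc k} P? j eq with last (P? ∘ suc) in eq′ | P? zero
last-satisfies P? _ refl | suc j | _      = last-satisfies (P? ∘ suc) j eq′
last-satisfies P? _ refl | zero  | yes P0 = P0
last-satisfies P? j ()   | zero  | no _

predecessor : {p q : Fin n} → p Fin.< q → ∃ λ (q′ : Fin n) → toℕ q ≡ suc (toℕ q′)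
predecessor {q = suc q} _ = Fin.inject₁ q , cong suc (sym (Fin.toℕ-inject₁ q))

lastElement : Fin n → ∃ λ (l : Fin n) → suc (toℕ l) ≡ n
lastElement {suc n} _ = Fin.fromℕ n , cong suc (Fin.toℕ-fromℕ n)

-- Laminar families of half-open intervals (d i, r i] with prescribed left ends

module Laminar (d : Fin k → Fin n) (d-mono : ∀ {i j} → i Fin.< j → d i Fin.< d j) where

  d-mono-≤ : ∀ {i j} → i Fin.≤ j → d i Fin.≤ d j
  d-mono-≤ {i} {j} i≤j with m≤n⇒m<n∨m≡n i≤j
  ... | inj₁ i<j = <⇒≤ (d-mono i<j)
  ... | inj₂ i≡j = ≤-reflexive (cong (toℕ ∘ d) (Fin.toℕ-injective i≡j))

  -- As left ends increase with the index, a later interval either lies inside an earlier one or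
  -- starts at or after its end; `r i ≡ d j` is the permitted contact of two hooks. Strict nesting
  -- keeps the right ends distinct.
  record IsLaminar (r : Fin k → Fin n) : Set where
    field
      right  : ∀ i → d i Fin.< r i
      nested : ∀ {i j} → i Fin.< j → d j Fin.< r i → r j Fin.< r i

    distinct : ∀ {i j} → i Fin.< j → r i ≢ r j
    distinct {i} {j} i<j ri≡rj = <-irrefl (cong toℕ (sym ri≡rj))
      (nested i<j (subst (d j Fin.<_) (sym ri≡rj) (right j)))

    injective : Injective _≡_ _≡_ r
    injective {i} {j} eq with Fin.<-cmp i j
    ... | tri< i<j _ _ = contradiction eq (distinct i<j)
    ... | tri≈ _ i≡j _ = i≡j
    ... | tri> _ _ j<i = contradiction (sym eq) (distinct j<i)

  isLaminar? : Decidable IsLaminar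
  isLaminar? r with Fin.all? (λ i → d i Fin.<? r i)
    | Fin.all? (λ i → Fin.all? (λ j → (i Fin.<? j) →-dec (d j Fin.<? r i) →-dec (r j Fin.<? r i)))
  ... | yes right | yes nested = yes record { right = right ; nested = λ {i} {j} → nested i j }
  ... | no ¬right | _          = no λ lam → ¬right (IsLaminar.right lam)
  ... | _         | no ¬nested = no λ lam → ¬nested λ i j → IsLaminar.nested lam

  open Algebra.Construct.NaturalChoice.Min (Fin.≤-totalOrder n) public
    using (_⊓_; ⊓-sel; x⊓y≤x; x⊓y≤y)

  -- The minimum at `i` is attained by one of the two families, and nesting in that family alone
  -- bounds the minimum at `j`.
  ⊓-laminar : ∀ {r r′} → IsLaminar r → IsLaminar r′ → IsLaminar (λ i → r i ⊓ r′ i)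
  ⊓-laminar {r} {r′} lam lam′ = record { right = right ; nested = nested }
    where
    right : ∀ i → d i Fin.< r i ⊓ r′ i
    right i with ⊓-sel (r i) (r′ i)
    ... | inj₁ eq = subst (d i Fin.<_) (sym eq) (IsLaminar.right lam i)
    ... | inj₂ eq = subst (d i Fin.<_) (sym eq) (IsLaminar.right lam′ i)
    nested : ∀ {i j} → i Fin.< j → d j Fin.< r i ⊓ r′ i → r j ⊓ r′ j Fin.< r i ⊓ r′ i
    nested {i} {j} i<j dj< with ⊓-sel (r i) (r′ i)
    ... | inj₁ eq = subst (r j ⊓ r′ j Fin.<_) (sym eq)
      (≤-<-trans (x⊓y≤x (r j) (r′ j)) (IsLaminar.nested lam i<j (subst (d j Fin.<_) eq dj<)))
    ... | inj₂ eq = subst (r j ⊓ r′ j Fin.<_) (sym eq)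
      (≤-<-trans (x⊓y≤y (r j) (r′ j)) (IsLaminar.nested lam′ i<j (subst (d j Fin.<_) eq dj<)))

  module _ (G : Fin k → Pred (Fin n) 0ℓ) where

    Admissible : Pred (Fin k → Fin n) 0ℓ
    Admissible r = (∀ i → G i (r i)) × IsLaminar r

    admissible-cong : ∀ {r r′} → r ≗ r′ → Admissible r → Admissible r′
    admissible-cong eq (good , lam) =
        (λ i → subst (G i) (eq i) (good i))
      , record
        { right  = λ i → subst (d i Fin.<_) (eq i) (IsLaminar.right lam i)
        ; nested = λ {i} {j} i<j dj< → subst₂ Fin._<_ (eq j) (eq i)
            (IsLaminar.nested lam i<j (subst (d j Fin.<_) (sym (eq i)) dj<)) }

    ⊓-admissible : ∀ {r r′} → Admissible r → Admissible r′ → Admissible (λ i → r i ⊓ r′ i)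
    ⊓-admissible {r} {r′} (good , lam) (good′ , lam′) = good″ , ⊓-laminar lam lam′
      where
      good″ : ∀ i → G i (r i ⊓ r′ i)
      good″ i with ⊓-sel (r i) (r′ i)
      ... | inj₁ eq = subst (G i) (sym eq) (good i)
      ... | inj₂ eq = subst (G i) (sym eq) (good′ i)

    -- All families are enumerated by `Fin (n ^ k)`, and the admissible ones are folded together by
    -- minima, starting from the given one. Decoding returns a family only up to pointwise equality,
    -- whence `admissible-cong`.
    leastAdmissible : (∀ i → Decidable (G i)) → ∃ Admissible →
      ∃ λ c → Admissible c × ∀ r → Admissible r → ∀ i → c i Fin.≤ r i
    leastAdmissible G? (r₀ , adm₀) with meets (allFin _)
      where
      admissible? : Decidable Admissible
      admissible? r = Fin.all? (λ i → G? i (r i)) ×-dec isLaminar? r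

      meets : (xs : List (Fin (n ^ k))) → ∃ λ c → Admissible c ×
              ∀ x → x List.∈ xs → Admissible (finToFun x) → ∀ i → c i Fin.≤ finToFun x i
      meets [] = r₀ , adm₀ , λ _ ()
      meets (x ∷ xs) with meets xs | admissible? (finToFun x)
      ... | c , adm , below | no ¬adm = c , adm , λ
        { _ (here refl) adm′ → contradiction adm′ ¬adm
        ; y (there y∈)  adm′ → below y y∈ adm′ }
      ... | c , adm , below | yes admₓ = (λ i → c i ⊓ finToFun x i) , ⊓-admissible adm admₓ , λ
        { _ (here refl) _    i → x⊓y≤y (c i) (finToFun x i)
        ; y (there y∈)  adm′ i → ≤-trans (x⊓y≤x (c i) (finToFun x i)) (below y y∈ adm′ i) }
    ... | c , adm , below = c , adm , λ r admᵣ i → subst (c i Fin.≤_) (Fin.finToFun-funToFin r i)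
      (below (funToFin r) (∈-allFin _) (admissible-cong (sym ∘ Fin.finToFun-funToFin r) admᵣ) i)

  -- Innermost intervals

  Covers : (Fin k → Fin n) → Fin n → Pred (Fin k) 0ℓ
  Covers r p i = d i Fin.< p × p Fin.≤ r i

  covers? : ∀ r p → Decidable (Covers r p)
  covers? r p i = (d i Fin.<? p) ×-dec (p Fin.≤? r i)

  -- In a laminar family, of all intervals containing `p` the one with the largest index lies inside
  -- the others.
  innermost : (Fin k → Fin n) → Fin n → Fin (suc k)
  innermost r p = last (covers? r p)

  -- An interval of larger index that contained `r i` would start before `r i`, hence by nesting
  -- also end before it.
  innermost-right : ∀ {r} → IsLaminar r → ∀ i → innermost r (r i) ≡ suc i
  innermost-right {r} lam i
    with innermost r (r i) in eq | last-upper (covers? r (r i)) i (IsLaminar.right lam i , ≤-refl)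
  ... | suc j | s≤s i≤j with last-satisfies (covers? r (r i)) j eq | m≤n⇒m<n∨m≡n i≤j
  ...   | dj<ri , ri≤rj | inj₁ i<j = contradiction (IsLaminar.nested lam i<j dj<ri) (≤⇒≯ ri≤rj)
  ...   | _             | inj₂ i≡j = cong suc (sym (Fin.toℕ-injective i≡j))

  -- Weights and lengths of intervals

  Started : Fin k → Fin n → Pred (Fin k) 0ℓ
  Started i p j = i Fin.≤ j × d j Fin.< p

  started? : ∀ i p → Decidable (Started i p)
  started? i p j = (i Fin.≤? j) ×-dec (d j Fin.<? p)

  -- With `w j` the number of points of innermost index `j`, the value at `p = r i` is the length of
  -- the i-th interval, by `fibres-close`.
  weight : (Fin k → ℕ) → Fin k → Fin n → ℕ
  weight w i p = sum (λ j → ι (started? i p j) * w j)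

  weight-mono : ∀ w i {p q} → p Fin.≤ q → weight w i p ≤ weight w i q
  weight-mono w i {p} {q} p≤q = sum-mono λ j → *-monoˡ-≤ (w j)
    (ι-mono (started? i p j) (started? i q j) (map₂ λ dj<p → <-≤-trans dj<p p≤q))

  weight-≥ : ∀ w i {p} → d i Fin.< p → w i ≤ weight w i p
  weight-≥ w i {p} di<p = ≤-trans (≤-reflexive (sym (sum-δ i w))) (sum-mono λ j → *-monoˡ-≤ (w j)
    (ι-mono (j Fin.≟ i) (started? i p j) λ { refl → ≤-refl , di<p }))

  -- The two sums on the left range over disjoint sets of indices, those below `j` and those from
  -- `j` on.
  weight-split : ∀ w {i j p} → i Fin.< j → d j Fin.< p →
                 weight w i (d j) + weight w j p ≤ weight w i p
  weight-split w {i} {j} {p} i<j dj<p = ≤-trans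
    (≤-reflexive (sym (∑-distrib-+ _ (λ x → ι (started? j p x) * w x))))
    (sum-mono λ x → ≤-trans (≤-reflexive (sym (*-distribʳ-+ (w x) (ι (started? i (d j) x)) _)))
                            (*-monoˡ-≤ (w x) (pointwise x)))
    where
    pointwise : ∀ x → ι (started? i (d j) x) + ι (started? j p x) ≤ ι (started? i p x)
    pointwise x with j Fin.≤? x
    ... | yes j≤x = ≤-trans (+-monoˡ-≤ _ (≤-reflexive
      (ι-no (started? i (d j) x) λ (_ , dx<dj) → <⇒≱ dx<dj (d-mono-≤ j≤x))))
      (ι-mono (started? j p x) (started? i p x) (map₁ (≤-trans (<⇒≤ i<j))))
    ... | no j≰x = ≤-trans (+-monoʳ-≤ (ι (started? i (d j) x)) (≤-reflexive
      (ι-no (started? j p x) λ (j≤x , _) → j≰x j≤x)))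
      (≤-trans (≤-reflexive (+-identityʳ _))
      (ι-mono (started? i (d j) x) (started? i p x) (map₂ (λ dx<dj → <-trans dx<dj dj<p))))

  Closes : (Fin k → ℕ) → (Fin k → Fin n) → Set
  Closes w r = ∀ i → weight w i (r i) + toℕ (d i) ≡ toℕ (r i)

  -- Induction from the last index downwards: the equation at `i` expresses `w i` through the
  -- weights of larger indices.
  closes-unique : ∀ {w w′ r} → (∀ i → d i Fin.< r i) → Closes w r → Closes w′ r → w ≗ w′
  closes-unique {w} {w′} {r} right eq eq′ i = go i (Fin.>-wellFounded i)
    where
    later? : ∀ i → Decidable (λ j → i Fin.< j × d j Fin.< r i)
    later? i j = (i Fin.<? j) ×-dec (d j Fin.<? r i)

    first : ∀ v i → weight v i (r i) ≡ v i + sum (λ j → ι (later? i j) * v j)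
    first v i = begin
      weight v i (r i)                                         ≡⟨ sum-cong-≗ (λ j → trans (cong (_* v j) (split j)) (*-distribʳ-+ (v j) (ι (j Fin.≟ i)) _)) ⟩
      sum (λ j → ι (j Fin.≟ i) * v j + ι (later? i j) * v j)   ≡⟨ ∑-distrib-+ _ (λ j → ι (later? i j) * v j) ⟩
      sum (λ j → ι (j Fin.≟ i) * v j) + sum (λ j → ι (later? i j) * v j) ≡⟨ cong (_+ sum (λ j → ι (later? i j) * v j)) (sum-δ i v) ⟩
      v i + sum (λ j → ι (later? i j) * v j) ∎
      where
      open ≡-Reasoning
      split : ∀ j → ι (started? i (r i) j) ≡ ι (j Fin.≟ i) + ι (later? i j)
      split j with j Fin.≟ i
      ... | yes refl = trans (ι-yes (started? i (r i) i) (≤-refl , right i))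
        (cong suc (sym (ι-no (later? i i) λ (i<i , _) → <-irrefl refl i<i)))
      ... | no j≢i = ι-cong (started? i (r i) j) (later? i j)
        (map₁ λ i≤j → Fin.≤∧≢⇒< i≤j (j≢i ∘ sym)) (map₁ <⇒≤)

    go : ∀ i → Acc Fin._>_ i → w i ≡ w′ i
    go i (acc rec) = +-cancelʳ-≡ (sum (λ j → ι (later? i j) * w′ j)) _ _ $ begin
      w i + sum (λ j → ι (later? i j) * w′ j)  ≡⟨ cong (w i +_) (sum-cong-≗ same) ⟨
      w i + sum (λ j → ι (later? i j) * w j)   ≡⟨ first w i ⟨
      weight w i (r i)                         ≡⟨ +-cancelʳ-≡ (toℕ (d i)) _ _ (trans (eq i) (sym (eq′ i))) ⟩
      weight w′ i (r i)                        ≡⟨ first w′ i ⟩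
      w′ i + sum (λ j → ι (later? i j) * w′ j) ∎
      where
      open ≡-Reasoning
      same : ∀ j → ι (later? i j) * w j ≡ ι (later? i j) * w′ j
      same j = ι-*-cong (later? i j) λ (i<j , _) → go j (rec i<j)

  -- By laminarity the points of `(d i, r i]` are exactly those whose innermost interval has index
  -- at least `i` and starts before `r i`; they are counted by that index.
  fibres-close : ∀ {r} → IsLaminar r → Closes (λ j → count (innermost r) (suc j)) r
  fibres-close {r} lam i = trans (cong (_+ toℕ (d i)) (begin
    weight (λ j → count (innermost r) (suc j)) i (r i)  ≡⟨ sum-fibres (innermost r) inside ⟨
    sum (inside ∘ innermost r)                          ≡⟨ sum-cong-≗ inside-between ⟩
    # (between? (d i) (r i))                            ∎)) (#-between (d i) (r i) (<⇒≤ (IsLaminar.right lam i)))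
    where
    open ≡-Reasoning
    inside : Fin (suc k) → ℕ
    inside zero    = 0
    inside (suc j) = ι (started? i (r i) j)

    inside-between : ∀ p → inside (innermost r p) ≡ ι (between? (d i) (r i) p)
    inside-between p with innermost r p | last-upper (covers? r p) | last-satisfies (covers? r p)
    ... | zero  | upper | _ = sym (ι-no (between? (d i) (r i) p) λ cov → contradiction (upper i cov) λ ())
    ... | suc j | upper | satisfies = ι-cong (started? i (r i) j) (between? (d i) (r i) p)
      (λ (i≤j , dj<ri) → ≤-<-trans (d-mono-≤ i≤j) dj<p , ≤-trans p≤rj (within i≤j dj<ri))
      (λ cov → s≤s⁻¹ (upper i cov) , <-≤-trans dj<p (proj₂ cov))
      where
      dj<p = proj₁ (satisfies j refl)
      p≤rj = proj₂ (satisfies j refl)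
      within : i Fin.≤ j → d j Fin.< r i → r j Fin.≤ r i
      within i≤j dj<ri with m≤n⇒m<n∨m≡n i≤j
      ... | inj₁ i<j = <⇒≤ (IsLaminar.nested lam i<j dj<ri)
      ... | inj₂ i≡j = ≤-reflexive (cong (toℕ ∘ r) (sym (Fin.toℕ-injective i≡j)))

  -- The interval from d i ends as soon as its length reaches the total weight of the
  -- intervals, from the i-th on, that start in it.
  module FromWeights {c : Fin k → Fin n} (c-right : ∀ i → d i Fin.< c i)
    (w : Fin k → ℕ) (w-positive : ∀ i → 0 < w i)
    (w-fits : ∀ i p → weight w i p + suc (toℕ (d i)) ≤ n)
    (w-late : ∀ i p → d i Fin.< p → p Fin.< c i → toℕ p < weight w i p + toℕ (d i)) where

    private
      Enough : Fin k → Pred (Fin n) 0ℓ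
      Enough i p = d i Fin.< p × weight w i p + toℕ (d i) ≤ toℕ p

      enough? : ∀ i → Decidable (Enough i)
      enough? i p = (d i Fin.<? p) ×-dec (weight w i p + toℕ (d i) ≤? toℕ p)

      -- At the last point `w-fits` leaves room for the whole weight, so the search for an end
      -- cannot fail.
      enough-at-end : ∀ i → ∃ (Enough i)
      enough-at-end i with lastElement (d i)
      ... | l , l+1≡n = l
        , <-≤-trans (c-right i) (s≤s⁻¹ (≤-trans (Fin.toℕ<n (c i)) (≤-reflexive (sym l+1≡n))))
        , s≤s⁻¹ (≤-trans (≤-reflexive (sym (+-suc _ (toℕ (d i)))))
                         (≤-trans (w-fits i l) (≤-reflexive (sym l+1≡n))))

      first : ∀ i → ∃ λ p → Enough i p × ∀ q → Enough i q → p Fin.≤ q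
      first i = least (enough? i) (enough-at-end i)

    ends : Fin k → Fin n
    ends i = proj₁ (first i)

    private
      ends-right : ∀ i → d i Fin.< ends i
      ends-right i = proj₁ (proj₁ (proj₂ (first i)))

      before-ends : ∀ i p → d i Fin.< p → p Fin.< ends i → toℕ p < weight w i p + toℕ (d i)
      before-ends i p di<p p<end = ≰⇒> λ enough →
        <⇒≱ p<end (proj₂ (proj₂ (first i)) p (di<p , enough))

    -- One inequality is the stopping condition. For the other, the point just before the end
    -- violates that condition and the weight is monotone; if that point is `d i` itself, positivity
    -- of `w i` suffices.
    ends-close : Closes w ends
    ends-close i = ≤-antisym (proj₂ (proj₁ (proj₂ (first i)))) lower
      where
      lower : toℕ (ends i) ≤ weight w i (ends i) + toℕ (d i)
      lower with predecessor (ends-right i)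
      ... | q , end≡1+q with m≤n⇒m<n∨m≡n (s≤s⁻¹ (subst (toℕ (d i) <_) end≡1+q (ends-right i)))
      ...   | inj₁ di<q = ≤-trans (≤-reflexive end≡1+q) (≤-trans
        (before-ends i q di<q q<end)
        (+-monoˡ-≤ (toℕ (d i)) (weight-mono w i (<⇒≤ q<end))))
        where
        q<end : q Fin.< ends i
        q<end = ≤-reflexive (sym end≡1+q)
      ...   | inj₂ di≡q = ≤-trans (≤-reflexive (trans end≡1+q (cong suc (sym di≡q))))
        (+-monoˡ-≤ (toℕ (d i)) (≤-trans (w-positive i) (weight-≥ w i (ends-right i))))

    -- The point `q` just before `ends i` already meets the stopping condition of `j`: at `d j` the
    -- weight for `i` still exceeded the distance from `d i`, and by `weight-split` only the
    -- remainder is left for `j`.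
    ends-laminar : IsLaminar ends
    ends-laminar = record { right = ends-right ; nested = nested }
      where
      nested : ∀ {i j} → i Fin.< j → d j Fin.< ends i → ends j Fin.< ends i
      nested {i} {j} i<j dj<end with predecessor dj<end
      ... | q , end≡1+q = <-≤-trans
        (s≤s (proj₂ (proj₂ (first j)) q (dj<q , ≤-trans (+-monoˡ-≤ (toℕ (d j)) (weight-mono w j (<⇒≤ q<end))) fits)))
        (≤-reflexive (sym end≡1+q))
        where
        q<end : q Fin.< ends i
        q<end = ≤-reflexive (sym end≡1+q)

        fits : weight w j (ends i) + toℕ (d j) ≤ toℕ q
        fits = s≤s⁻¹ (begin
          suc (weight w j (ends i) + toℕ (d j))                              ≡⟨ +-suc _ (toℕ (d j)) ⟨
          weight w j (ends i) + suc (toℕ (d j))                              ≤⟨ +-monoʳ-≤ (weight w j (ends i)) (before-ends i (d j) (d-mono i<j) dj<end) ⟩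
          weight w j (ends i) + (weight w i (d j) + toℕ (d i))               ≡⟨ solve 3 (λ x y z → x :+ (y :+ z) := y :+ x :+ z) refl (weight w j (ends i)) (weight w i (d j)) (toℕ (d i)) ⟩
          weight w i (d j) + weight w j (ends i) + toℕ (d i)                 ≤⟨ +-monoˡ-≤ (toℕ (d i)) (weight-split w i<j dj<end) ⟩
          weight w i (ends i) + toℕ (d i)                                    ≡⟨ ends-close i ⟩
          toℕ (ends i)                                                       ≡⟨ end≡1+q ⟩
          suc (toℕ q)                                                        ∎)
          where
          open ≤-Reasoning
          open +-*-Solver using (solve; _:+_; _:=_)

        dj<q : d j Fin.< q
        dj<q = ≤-trans (+-monoˡ-≤ (toℕ (d j)) (≤-trans (w-positive j) (weight-≥ w j dj<end))) fits

    -- Before `c i` the weight exceeds the length by `w-late`, so no interval can close there.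
    ends-≥ : ∀ i → c i Fin.≤ ends i
    ends-≥ i = ≮⇒≥ λ end<c → <-irrefl (sym (ends-close i)) (w-late i (ends i) (ends-right i) end<c)

  -- Assignments of colours to the points other than the `c i`

  module Assignments {c : Fin k → Fin n} (c-laminar : IsLaminar c) where

    Begun : Fin (suc k) → Pred (Fin n) 0ℓ
    Begun zero    p = ⊤
    Begun (suc j) p = d j Fin.< p

    -- This is membership of `x` in the set I_p. The inequality is strict because the i-th interval
    -- has colour `suc i`.
    Allowed : Fin (suc k) → Pred (Fin n) 0ℓ
    Allowed x p = Begun x p × ∀ i → Covers c p i → toℕ i < toℕ x

    allowed? : ∀ x → Decidable (Allowed x)
    allowed? x p = begun? x ×-dec Fin.all? λ i → covers? c p i →-dec (toℕ i <? toℕ x)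
      where
      begun? : ∀ x → Dec (Begun x p)
      begun? zero    = yes tt
      begun? (suc j) = d j Fin.<? p

    begun-mono : ∀ x {p q} → p Fin.≤ q → Begun x p → Begun x q
    begun-mono zero    _   _    = tt
    begun-mono (suc j) p≤q dj<p = <-≤-trans dj<p p≤q

    -- Enlarging the right ends from `c` to `r` keeps every covering interval, so the innermost
    -- index for `r` is at least each index covering `p` in `c`.
    innermost-allowed : ∀ r → (∀ i → c i Fin.≤ r i) → ∀ p → Allowed (innermost r p) p
    innermost-allowed r c≤r p = begun (innermost r p) refl
      , λ i (di<p , p≤ci) → last-upper (covers? r p) i (di<p , ≤-trans p≤ci (c≤r i))
      where
      begun : ∀ x → innermost r p ≡ x → Begun x p
      begun zero    _  = tt
      begun (suc j) eq = proj₁ (last-satisfies (covers? r p) j eq)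

    free : Fin (length (complement c)) → Fin n
    free = List.lookup (complement c)

    c-injective : Injective _≡_ _≡_ c
    c-injective = IsLaminar.injective c-laminar

    -- Interchanging the colours of c j and of a point p ≥ c j of colour suc j keeps
    -- all colours allowed.
    recolour : (g : Fin n → Fin (suc k)) → (∀ p → Allowed (g p) p) →
      (∀ i → ∃ λ p → c i Fin.≤ p × g p ≡ suc i) → ∀ t → t ≤ k →
      ∃ λ g′ → (∀ p → Allowed (g′ p) p) × (∀ x → count g′ x ≡ count g x) ×
        (∀ i → ∃ λ p → c i Fin.≤ p × g′ p ≡ suc i) × (∀ i → toℕ i < t → g′ (c i) ≡ suc i)
    recolour g allowed witness zero    _   = g , allowed , (λ _ → refl) , witness , λ _ ()
    recolour g allowed witness (suc t) t<k with recolour g allowed witness t (<⇒≤ t<k)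
    ... | g₀ , allowed₀ , count₀ , witness₀ , fixed₀ = g₂ , allowed₂ , count₂ , witness₂ , fixed₂
      where
      j = Fin.fromℕ< t<k
      p = proj₁ (witness₀ j)
      cj≤p = proj₁ (proj₂ (witness₀ j))
      g₀p≡j = proj₂ (proj₂ (witness₀ j))
      x = g₀ (c j)
      g₁ = updateAt g₀ p (const x)
      g₂ = updateAt g₁ (c j) (const (suc j))

      g₂-j : g₂ (c j) ≡ suc j
      g₂-j = updateAt-updates (c j) g₁

      g₂-p : p ≢ c j → g₂ p ≡ x
      g₂-p p≢cj = trans (updateAt-minimal p (c j) g₁ p≢cj) (updateAt-updates p g₀)

      g₂-other : ∀ {q} → q ≢ c j → q ≢ p → g₂ q ≡ g₀ q
      g₂-other {q} q≢cj q≢p = trans (updateAt-minimal q (c j) g₁ q≢cj) (updateAt-minimal q p g₀ q≢p)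

      -- This holds also if `p` is `c j`, so `count₂` needs no case distinction.
      g₁-j : g₁ (c j) ≡ x
      g₁-j with c j Fin.≟ p
      ... | yes cj≡p = trans (cong g₁ cj≡p) (updateAt-updates p g₀)
      ... | no cj≢p  = updateAt-minimal (c j) p g₀ cj≢p

      -- Since `p` has colour `suc j`, the intervals of `c` covering it have index at most `j`; and
      -- `x`, being allowed at `c j`, is at least `suc j`.
      x-allowed-at-p : Allowed x p
      x-allowed-at-p = begun-mono x cj≤p (proj₁ (allowed₀ (c j)))
        , λ i cov → <-≤-trans (subst (λ z → toℕ i < toℕ z) g₀p≡j (proj₂ (allowed₀ p) i cov))
            (proj₂ (allowed₀ (c j)) j (IsLaminar.right c-laminar j , ≤-refl))

      j-allowed : Allowed (suc j) (c j)
      j-allowed = IsLaminar.right c-laminar j , below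
        where
        below : ∀ i → Covers c (c j) i → toℕ i < suc (toℕ j)
        below i (di<cj , cj≤ci) = s≤s (≮⇒≥ λ j<i →
          <⇒≱ (IsLaminar.nested c-laminar j<i di<cj) cj≤ci)

      allowed₂ : ∀ q → Allowed (g₂ q) q
      allowed₂ q with q Fin.≟ c j | q Fin.≟ p
      ... | yes refl | _        = subst (λ z → Allowed z (c j)) (sym g₂-j) j-allowed
      ... | no q≢cj  | yes refl = subst (λ z → Allowed z p) (sym (g₂-p q≢cj)) x-allowed-at-p
      ... | no q≢cj  | no q≢p   = subst (λ z → Allowed z q) (sym (g₂-other q≢cj q≢p)) (allowed₀ q)

      count₂ : ∀ y → count g₂ y ≡ count g y
      count₂ y = trans (+-cancelʳ-≡ (ι (x Fin.≟ y)) _ _ (+-cancelʳ-≡ (ι (suc j Fin.≟ y)) _ _ (begin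
        count g₂ y + X + Y                           ≡⟨ cong (λ z → count g₂ y + ι (z Fin.≟ y) + Y) g₁-j ⟨
        count g₂ y + ι (g₁ (c j) Fin.≟ y) + Y        ≡⟨ cong (_+ Y) (count-updateAt g₁ (c j) (suc j) y) ⟩
        count g₁ y + Y + Y                           ≡⟨ cong (λ z → count g₁ y + ι (z Fin.≟ y) + Y) g₀p≡j ⟨
        count g₁ y + ι (g₀ p Fin.≟ y) + Y            ≡⟨ cong (_+ Y) (count-updateAt g₀ p x y) ⟩
        count g₀ y + X + Y                           ∎))) (count₀ y)
        where
        open ≡-Reasoning
        X = ι (x Fin.≟ y)
        Y = ι (suc j Fin.≟ y)

      witness₂ : ∀ i → ∃ λ q → c i Fin.≤ q × g₂ q ≡ suc i
      witness₂ i with witness₀ i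
      ... | q , ci≤q , g₀q≡i with i Fin.≟ j | q Fin.≟ c j | q Fin.≟ p
      ...   | yes refl | _        | _        = c j , ≤-refl , g₂-j
      ...   | no i≢j   | _        | yes refl = contradiction (Fin.suc-injective (trans (sym g₀q≡i) g₀p≡j)) i≢j
      ...   | no i≢j   | no q≢cj  | no q≢p   = q , ci≤q , trans (g₂-other q≢cj q≢p) g₀q≡i
      -- If the witness for `i` was `c j`, its colour has moved to `p`, which is still beyond `c i`.
      ...   | no i≢j   | yes refl | no cj≢p  = p , ≤-trans ci≤q cj≤p , trans (g₂-p (cj≢p ∘ sym)) g₀q≡i

      fixed₂ : ∀ i → toℕ i < suc t → g₂ (c i) ≡ suc i
      fixed₂ i i≤t with i Fin.≟ j
      ... | yes refl = g₂-j
      ... | no i≢j = trans (g₂-other (i≢j ∘ c-injective) ci≢p) fixed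
        where
        i<t : toℕ i < t
        i<t = ≤∧≢⇒< (s≤s⁻¹ i≤t) λ i≡t →
          i≢j (Fin.toℕ-injective (trans i≡t (sym (Fin.toℕ-fromℕ< t<k))))
        fixed = fixed₀ i i<t
        -- Points `c i` treated earlier are not disturbed: their colour `suc i` differs from the
        -- colour `suc j` of `p`.
        ci≢p : c i ≢ p
        ci≢p ci≡p = i≢j (Fin.suc-injective (trans (sym fixed) (trans (cong g₀ ci≡p) g₀p≡j)))

    -- The points `r i` are the initial witnesses for `recolour`. Afterwards the `c i` contribute
    -- `count suc`, and the restriction to the free points is the assignment.
    assignment-of-laminar : ∀ r → IsLaminar r → (∀ i → c i Fin.≤ r i) →
      ∃ λ (s : Fin (length (complement c)) → Fin (suc k)) →
        (∀ q → Allowed (s q) (free q)) × (∀ x → count (innermost r) x ≡ count s x + count suc x)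
    assignment-of-laminar r r-laminar c≤r
      with recolour (innermost r) (innermost-allowed r c≤r)
             (λ i → r i , c≤r i , innermost-right r-laminar i) k ≤-refl
    ... | g , allowed , count-g , _ , fixed = g ∘ free , allowed ∘ free , λ x → begin
      count (innermost r) x               ≡⟨ count-g x ⟨
      count g x                           ≡⟨ sum-split c c-injective (λ p → ι (g p Fin.≟ x)) ⟩
      count (g ∘ free) x + count (g ∘ c) x ≡⟨ cong (count (g ∘ free) x +_) (sum-cong-≗ λ i →
                                               cong (λ z → ι (z Fin.≟ x)) (fixed i (Fin.toℕ<n i))) ⟩
      count (g ∘ free) x + count suc x    ∎
      where open ≡-Reasoning

    -- Giving each `c i` the index `i`, the assignment prescribes the number `T x` of points of each
    -- index. These numbers are the weights from which the right ends are built.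
    laminar-of-assignment : (s : Fin (length (complement c)) → Fin (suc k)) →
      (∀ q → Allowed (s q) (free q)) →
      ∃ λ r → IsLaminar r × (∀ i → c i Fin.≤ r i) ×
        (∀ x → count (innermost r) x ≡ count s x + count suc x)
    laminar-of-assignment s allowed = ends , ends-laminar , ends-≥ , counts
      where
      T : Fin (suc k) → ℕ
      T x = count s x + count suc x

      w : Fin k → ℕ
      w j = T (suc j)

      total : (φ : Fin (suc k) → ℕ) → sum (φ ∘ s) + sum (φ ∘ suc) ≡ sum (λ x → φ x * T x)
      total φ = begin
        sum (φ ∘ s) + sum (φ ∘ suc) ≡⟨ cong₂ _+_ (sum-fibres s φ) (sum-fibres suc φ) ⟩
        sum (λ x → φ x * count s x) + sum (λ x → φ x * count suc x) ≡⟨ ∑-distrib-+ (λ x → φ x * count s x) (λ x → φ x * count suc x) ⟨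
        sum (λ x → φ x * count s x + φ x * count suc x) ≡⟨ sum-cong-≗ (λ x → *-distribˡ-+ (φ x) (count s x) (count suc x)) ⟨
        sum (λ x → φ x * T x) ∎
        where open ≡-Reasoning

      inside : Fin k → Fin n → Fin (suc k) → ℕ
      inside i p zero    = 0
      inside i p (suc j) = ι (started? i p j)

      weight-total : ∀ i p → sum (inside i p ∘ s) + sum (inside i p ∘ suc) ≡ weight w i p
      weight-total i p = total (inside i p)

      -- Every free point and every `c j` that contributes to the weight lies beyond `d i`, and the
      -- points beyond `d i` can be counted.
      fits : ∀ i p → weight w i p + suc (toℕ (d i)) ≤ n
      fits i p = begin
        weight w i p + suc (toℕ (d i))                                 ≡⟨ cong (_+ suc (toℕ (d i))) (weight-total i p) ⟨
        sum (inside i p ∘ s) + sum (inside i p ∘ suc) + suc (toℕ (d i)) ≤⟨ +-monoˡ-≤ (suc (toℕ (d i))) (+-mono-≤ (sum-mono free-beyond) (sum-mono c-beyond)) ⟩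
        sum (β ∘ free) + sum (β ∘ c) + suc (toℕ (d i))                  ≡⟨ cong (_+ suc (toℕ (d i))) (sum-split c c-injective β) ⟨
        # (beyond? (d i)) + suc (toℕ (d i))                             ≡⟨ #-beyond (d i) ⟩
        n                                                               ∎
        where
        open ≤-Reasoning
        β : Fin n → ℕ
        β q = ι (beyond? (d i) q)
        free-beyond : ∀ q → inside i p (s q) ≤ β (free q)
        free-beyond q with s q | allowed q
        ... | zero  | _        = z≤n
        ... | suc j | dj<q , _ = ι-mono (started? i p j) (beyond? (d i) (free q))
          λ (i≤j , _) → ≤-<-trans (d-mono-≤ i≤j) dj<q
        c-beyond : ∀ j → ι (started? i p j) ≤ β (c j)
        c-beyond j = ι-mono (started? i p j) (beyond? (d i) (c j))
          λ (i≤j , _) → ≤-<-trans (d-mono-≤ i≤j) (IsLaminar.right c-laminar j)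

      -- Every point of `(d i, p]` contributes to the weight: a free one because it lies in
      -- `(d i, c i]` and its colour is allowed, a point `c j` because nesting forces `i ≤ j`. In
      -- addition `c i` contributes although it lies beyond `p`, which gives strictness.
      late : ∀ i p → d i Fin.< p → p Fin.< c i → toℕ p < weight w i p + toℕ (d i)
      late i p di<p p<ci = begin-strict
        toℕ p                                                   ≡⟨ #-between (d i) p (<⇒≤ di<p) ⟨
        # (between? (d i) p) + toℕ (d i)                         <⟨ +-monoˡ-< (toℕ (d i)) more ⟩
        sum (inside i p ∘ s) + sum (inside i p ∘ suc) + toℕ (d i) ≡⟨ cong (_+ toℕ (d i)) (weight-total i p) ⟩
        weight w i p + toℕ (d i)                                 ∎
        where
        open ≤-Reasoning
        β : Fin n → ℕ
        β q = ι (between? (d i) p q)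
        free-between : ∀ q → β (free q) ≤ inside i p (s q)
        free-between q with s q | allowed q
        ... | zero  | _ , upper = ≤-reflexive (ι-no (between? (d i) p (free q))
          λ (di<q , q≤p) → contradiction (upper i (di<q , ≤-trans q≤p (<⇒≤ p<ci))) λ ())
        ... | suc j | dj<q , upper = ι-mono (between? (d i) p (free q)) (started? i p j)
          λ (di<q , q≤p) → s≤s⁻¹ (upper i (di<q , ≤-trans q≤p (<⇒≤ p<ci))) , <-≤-trans dj<q q≤p
        c-between : ∀ j → β (c j) + ι (j Fin.≟ i) ≤ ι (started? i p j)
        c-between j with j Fin.≟ i
        ... | yes refl = ≤-reflexive (trans (cong (_+ 1)
            (ι-no (between? (d i) p (c i)) λ (_ , ci≤p) → <⇒≱ p<ci ci≤p))
            (sym (ι-yes (started? i p i) (≤-refl , di<p))))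
        ... | no j≢i = ≤-trans (≤-reflexive (+-identityʳ _)) (ι-mono (between? (d i) p (c j)) (started? i p j)
            λ (di<cj , cj≤p) →
                ≮⇒≥ (λ j<i → <-asym (≤-<-trans cj≤p p<ci) (IsLaminar.nested c-laminar j<i di<cj))
              , <-≤-trans (IsLaminar.right c-laminar j) cj≤p)
        more : # (between? (d i) p) < sum (inside i p ∘ s) + sum (inside i p ∘ suc)
        more = begin
          suc (# (between? (d i) p))                      ≡⟨ +-comm 1 _ ⟩
          # (between? (d i) p) + 1                        ≡⟨ cong₂ _+_ (sum-split c c-injective β) (sym (#-singleton i)) ⟩
          sum (β ∘ free) + sum (β ∘ c) + # (Fin._≟ i)     ≡⟨ +-assoc (sum (β ∘ free)) (sum (β ∘ c)) _ ⟩
          sum (β ∘ free) + (sum (β ∘ c) + # (Fin._≟ i))   ≡⟨ cong (sum (β ∘ free) +_) (∑-distrib-+ (β ∘ c) (λ j → ι (j Fin.≟ i))) ⟨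
          sum (β ∘ free) + sum (λ j → β (c j) + ι (j Fin.≟ i)) ≤⟨ +-mono-≤ (sum-mono free-between) (sum-mono c-between) ⟩
          sum (inside i p ∘ s) + sum (inside i p ∘ suc)   ∎

      positive : ∀ j → 0 < w j
      positive j = ≤-trans (≤-reflexive (sym (count-suc j))) (m≤n+m _ (count s (suc j)))

      open FromWeights (IsLaminar.right c-laminar) w positive fits late

      counts : ∀ x → count (innermost ends) x ≡ T x
      counts (suc j) = closes-unique (IsLaminar.right ends-laminar) (fibres-close ends-laminar) ends-close j
      -- The sky receives what the intervals leave, as both families of counts sum to `n`.
      counts zero    = +-cancelʳ-≡ (sum w) _ _ (begin
        count (innermost ends) zero + sum w                    ≡⟨ cong (count (innermost ends) zero +_) (sum-cong-≗ (counts ∘ suc)) ⟨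
        sum (count (innermost ends))                           ≡⟨ sum-cong-≗ (λ x → +-identityʳ (count (innermost ends) x)) ⟨
        sum (λ x → 1 * count (innermost ends) x)               ≡⟨ sum-fibres (innermost ends) (const 1) ⟨
        sum {n} (const 1)                                      ≡⟨ sum-split c c-injective (const 1) ⟩
        sum {length (complement c)} (const 1) + sum {k} (const 1) ≡⟨ total (const 1) ⟩
        sum (λ x → 1 * T x)                                    ≡⟨ sum-cong-≗ (λ x → +-identityʳ (T x)) ⟩
        T zero + sum w                                         ∎)
        where open ≡-Reasoning

-- Hooks

-- `fromℕ` normalises by a gcd, which does not compute for a variable `m`; in the explicit form with
-- denominator one, comparison reduces to the numerators.
fromℕ-mkℚ : ∀ m → fromℕ m ≡ mkℚ (ℤ.+ m) 0 (Coprime.sym (Coprime.1-coprimeTo m))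
fromℕ-mkℚ m = ℚ.normalize-coprime (Coprime.sym (Coprime.1-coprimeTo m))

fromℕ-mono-≤ : ∀ {x y} → x ≤ y → fromℕ x ℚ.≤ fromℕ y
fromℕ-mono-≤ {x} {y} x≤y = subst₂ ℚ._≤_ (sym (fromℕ-mkℚ x)) (sym (fromℕ-mkℚ y))
  (ℚ.*≤* (ℤ.*-monoʳ-≤-nonNeg (ℤ.+ 1) (ℤ.+≤+ x≤y)))

fromℕ-cancel-≤ : ∀ {x y} → fromℕ x ℚ.≤ fromℕ y → x ≤ y
fromℕ-cancel-≤ {x} {y} x≤y with subst₂ ℚ._≤_ (fromℕ-mkℚ x) (fromℕ-mkℚ y) x≤y
... | ℚ.*≤* le = ℤ.drop‿+≤+ (ℤ.*-cancelʳ-≤-pos (ℤ.+ x) (ℤ.+ y) (ℤ.+ 1) le)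

fromℕ-injective : ∀ {x y} → fromℕ x ≡ fromℕ y → x ≡ y
fromℕ-injective eq = ≤-antisym (fromℕ-cancel-≤ (ℚ.≤-reflexive eq)) (fromℕ-cancel-≤ (ℚ.≤-reflexive (sym eq)))

lookup-AllPairs : ∀ {ℓ} {A : Set a} {R : Rel A ℓ} {xs : List A} → AllPairs R xs →
                  ∀ {i j} → i Fin.< j → R (List.lookup xs i) (List.lookup xs j)
lookup-AllPairs {xs = _ ∷ xs} (x~ ∷ _)   {zero}  {suc j} _   = All.lookup x~ (∈-lookup {xs = xs} j)
lookup-AllPairs {xs = _ ∷ _}  (_  ∷ xs~) {suc i} {suc j} i<j = lookup-AllPairs xs~ (s<s⁻¹ i<j)

module _ {n : ℕ} (π : Permutation n) where
  open Permutation π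

  d : Fin (#descents π) → Fin n
  d = descent π

  d-mono : ∀ {i j} → i Fin.< j → d i Fin.< d j
  d-mono = lookup-AllPairs {R = Fin._<_} (AllPairs.filter⁺ (isDescent? π) (AllPairs.tabulate⁺-< {f = λ i → i} λ i<j → i<j))

  d-surjective : ∀ {p} → IsDescent π p → ∃ λ j → d j ≡ p
  d-surjective {p} desc = Any.index p∈ , sym (lookup-index p∈)
    where
    p∈ : p List.∈ descents π
    p∈ = ∈-filter⁺ (isDescent? π) (∈-allFin p) desc

  open Laminar d d-mono

  val-< : ∀ {p q} → val p ≤ val q → p ≢ q → val p < val q
  val-< p≤q p≢q = ≤∧≢⇒< p≤q (p≢q ∘ injective)

  -- What a valid configuration demands of a single hook from `d i` to `p`: it rises and no point
  -- lies directly above it.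
  Peak : Fin (#descents π) → Pred (Fin n) 0ℓ
  Peak i p = val (d i) < val p × ∀ m → d i Fin.< m → m Fin.< p → val m ≤ val p

  peak? : ∀ i → Decidable (Peak i)
  peak? i p = (val (d i) <? val p) ×-dec
    Fin.all? λ m → (d i Fin.<? m) →-dec (m Fin.<? p) →-dec (val m ≤? val p)

  -- The columns of the vertical segments, and the heights of the horizontal ones, are distinct, and
  -- hook `j` starts to the right of hook `i`. Only the horizontal segment of `i` can meet the
  -- vertical one of `j`; unless they touch at the permitted point, `j` is nested in `i` and too
  -- low.
  hooks-disjoint : ∀ {i j : Hook π} →
    Hook.sw i Fin.< Hook.sw j → (Hook.sw j Fin.< Hook.ne i → Hook.ne j Fin.< Hook.ne i) →
    (∀ m → Hook.sw i Fin.< m → m Fin.< Hook.ne i → val m ≤ val (Hook.ne i)) →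
    ∀ p → OnHook π i p → OnHook π j p → p ≡ plotPoint π (Hook.ne i) × p ≡ plotPoint π (Hook.sw j)
  hooks-disjoint {i} {j} si<sj nested below _ = λ
    { (inj₁ (refl , _)) (inj₁ (x≡ , _)) → contradiction (suc-injective (fromℕ-injective x≡)) (<⇒≢ si<sj)
    ; (inj₁ (refl , _)) (inj₂ (_ , sj≤x , _)) → contradiction (s≤s⁻¹ (fromℕ-cancel-≤ sj≤x)) (<⇒≱ si<sj)
    ; (inj₂ (refl , _ , x≤ni)) (inj₁ (refl , _ , y≤nj)) → corner (s≤s⁻¹ (fromℕ-cancel-≤ x≤ni)) (fromℕ-cancel-≤ y≤nj)
    ; (inj₂ (refl , _)) (inj₂ (y≡ , _)) → contradiction (injective (fromℕ-injective y≡)) ni≢nj }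
    where
    ni = Hook.ne i
    nj = Hook.ne j
    sj = Hook.sw j
    corner : sj Fin.≤ ni → val ni ≤ val nj →
      (abscissa π sj , ordinate π ni) ≡ plotPoint π ni × (abscissa π sj , ordinate π ni) ≡ plotPoint π sj
    corner sj≤ni ni≤nj = case m≤n⇒m<n∨m≡n sj≤ni of λ
      { (inj₂ sj≡ni) → cong (_, ordinate π ni) (cong (abscissa π) (Fin.toℕ-injective sj≡ni))
                     , cong (abscissa π sj ,_) (cong (ordinate π) (sym (Fin.toℕ-injective sj≡ni)))
      ; (inj₁ sj<ni) → contradiction ni≤nj (<⇒≱ (val-<
          (below nj (<-trans si<sj (Hook.sw<ne j)) (nested sj<ni))
          λ nj≡ni → <-irrefl (cong toℕ nj≡ni) (nested sj<ni))) }
    ni≢nj : ni ≢ nj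
    ni≢nj ni≡nj = <-irrefl (cong toℕ (sym ni≡nj)) (nested (subst (sj Fin.<_) (sym ni≡nj) (Hook.sw<ne j)))

  -- From valid hook configurations to laminar families

  module _ (H : VHC π) where
    open VHC H

    ends : Fin (#descents π) → Fin n
    ends i = Hook.ne (hook i)

    ends-admissible : Admissible Peak ends
    ends-admissible = peak , record { right = right ; nested = nested }
      where
      peak : ∀ i → Peak i (ends i)
      peak i = subst (λ s → val s < val (ends i)) (startsAtDescent i) (Hook.rises (hook i))
        , λ m di<m m<end → ≮⇒≥ λ end<m → noneAbove i m
            (subst (Fin._< m) (sym (startsAtDescent i)) di<m , m<end , end<m)

      right : ∀ i → d i Fin.< ends i
      right i = subst (Fin._< ends i) (startsAtDescent i) (Hook.sw<ne (hook i))

      -- Otherwise the vertical segment at d j meets the horizontal segment ending at ends i.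
      nested : ∀ {i j} → i Fin.< j → d j Fin.< ends i → ends j Fin.< ends i
      nested {i} {j} i<j dj<end = ≰⇒> λ endi≤endj → meet endi≤endj
        (noCrossing i j (<⇒≢ i<j ∘ cong toℕ) (abscissa π (d j) , ordinate π (ends i))
          (inj₂ (refl
            , fromℕ-mono-≤ (s≤s (≤-trans (≤-reflexive (cong toℕ (startsAtDescent i))) (<⇒≤ (d-mono i<j))))
            , fromℕ-mono-≤ (s≤s (<⇒≤ dj<end))))
          (inj₁ (cong (abscissa π) (sym (startsAtDescent j))
            , fromℕ-mono-≤ (≤-trans (≤-reflexive (cong val (startsAtDescent j)))
                                    (proj₂ (peak i) (d j) (d-mono i<j) dj<end))
            , fromℕ-mono-≤ (height endi≤endj))))
        where
        -- If hook `j` reaches at least as far as `ends i`, that point is not above it, so the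
        -- vertical segment at `d j` attains its height.
        height : ends i Fin.≤ ends j → val (ends i) ≤ val (ends j)
        height le with m≤n⇒m<n∨m≡n le
        ... | inj₁ lt = proj₂ (peak j) (ends i) dj<end lt
        ... | inj₂ eq = ≤-reflexive (cong val (Fin.toℕ-injective eq))
        column : ∀ {q} {y y′ : ℚ} → (abscissa π (d j) , y) ≡ (abscissa π q , y′) → toℕ (d j) ≡ toℕ q
        column eq = suc-injective (fromℕ-injective (cong proj₁ eq))
        -- The common point has abscissa `d j`, which is that of neither northeast endpoint, so it
        -- is not a permitted contact.
        meet : ends i Fin.≤ ends j → _ → _
        meet _  (inj₁ (eq , _)) = <⇒≢ dj<end (column eq)
        meet le (inj₂ (eq , _)) = <⇒≢ (<-≤-trans dj<end le) (column eq)

    private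
      lam : IsLaminar ends
      lam = proj₂ ends-admissible

      h : Fin n → Fin (suc (#descents π))
      h = innermost ends

      covers⇒below : ∀ i p → Covers ends p i → p ≢ ends i → DirectlyBelow π p (hook i)
      covers⇒below i p (di<p , p≤end) p≢end = subst (Fin._< p) (sym (startsAtDescent i)) di<p
        , p<end , val-< (proj₂ (proj₁ ends-admissible i) p di<p p<end) p≢end
        where
        p<end : p Fin.< ends i
        p<end = Fin.≤∧≢⇒< p≤end p≢end

      below⇒covers : ∀ i p → DirectlyBelow π p (hook i) → Covers ends p i
      below⇒covers i p (s<p , p<end , _) = subst (Fin._< p) (startsAtDescent i) s<p , <⇒≤ p<end

      -- The inner right end lies within the outer interval, where `ends i` is the peak. Hence the
      -- lowest hook above a point is the innermost one.
      inner-lower : ∀ {i j p} → Covers ends p i → Covers ends p j → i Fin.< j → val (ends j) < val (ends i)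
      inner-lower {i} {j} (di<p , p≤endi) (dj<p , p≤endj) i<j = val-<
        (proj₂ (proj₁ ends-admissible i) (ends j) (<-≤-trans di<p p≤endj) endj<endi)
        (λ eq → <-irrefl (cong toℕ eq) endj<endi)
        where endj<endi = IsLaminar.nested lam i<j (<-≤-trans dj<p p≤endi)

      innermost⇒colour : ∀ i p → h p ≡ suc i → p ≢ ends i → Coloured π H (suc i) p
      innermost⇒colour i p hp≡i p≢end = notEnd , covers⇒below i p cov p≢end , lowest
        where
        cov = last-satisfies (covers? ends p) i hp≡i
        notEnd : ¬ IsNortheastEndpoint π H p
        notEnd (j , end≡p) = p≢end (trans (sym end≡p) (cong ends (Fin.suc-injective
          (trans (sym (innermost-right lam j)) (trans (cong h end≡p) hp≡i)))))
        lowest : ∀ j → DirectlyBelow π p (hook j) → val (ends i) ≤ val (ends j)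
        lowest j below with m≤n⇒m<n∨m≡n (s≤s⁻¹ (subst (λ x → toℕ j < toℕ x) hp≡i
                              (last-upper (covers? ends p) j (below⇒covers j p below))))
        ... | inj₁ j<i = <⇒≤ (inner-lower (below⇒covers j p below) cov j<i)
        ... | inj₂ j≡i = ≤-reflexive (cong (val ∘ ends) (sym (Fin.toℕ-injective j≡i)))

      colour⇒innermost : ∀ i p → Coloured π H (suc i) p → h p ≡ suc i
      colour⇒innermost i p (notEnd , below , lowest)
        with h p in eq | last-upper (covers? ends p) i (below⇒covers i p below)
      ... | suc j | s≤s i≤j with m≤n⇒m<n∨m≡n i≤j
      ...   | inj₂ i≡j = cong suc (sym (Fin.toℕ-injective i≡j))
      ...   | inj₁ i<j = contradiction
        (lowest j (covers⇒below j p cov λ p≡end → notEnd (j , sym p≡end)))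
        (<⇒≱ (inner-lower (below⇒covers i p below) cov i<j))
        where cov = last-satisfies (covers? ends p) j eq

      innermost⇒sky : ∀ p → h p ≡ zero → Coloured π H zero p
      innermost⇒sky p hp≡0 = (λ { (j , refl) → contradiction (trans (sym hp≡0) (innermost-right lam j)) λ () })
        , λ i below → contradiction
            (subst (λ x → toℕ i < toℕ x) hp≡0 (last-upper (covers? ends p) i (below⇒covers i p below))) λ ()

      sky⇒innermost : ∀ p → Coloured π H zero p → h p ≡ zero
      sky⇒innermost p (notEnd , uncovered) with h p in eq
      ... | zero  = refl
      ... | suc j = contradiction
        (covers⇒below j p (last-satisfies (covers? ends p) j eq) λ p≡end → notEnd (j , sym p≡end))
        (uncovered j)

    -- A northeast endpoint `ends i` is uncoloured but has innermost index `suc i`; on all other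
    -- points colour and innermost index agree.
    count-innermost : ∀ x → count (innermost ends) x ≡ # (coloured? π H x) + count suc x
    count-innermost zero = trans
      (#-cong (λ p → h p Fin.≟ zero) (coloured? π H zero) innermost⇒sky sky⇒innermost)
      (sym (trans (cong (# (coloured? π H zero) +_) (sum-zero {#descents π} λ _ → refl)) (+-identityʳ _)))
    count-innermost (suc i) = begin
      count h (suc i)                                            ≡⟨ sum-cong-≗ pointwise ⟩
      sum (λ p → ι (coloured? π H (suc i) p) + ι (p Fin.≟ ends i)) ≡⟨ ∑-distrib-+ _ (λ p → ι (p Fin.≟ ends i)) ⟩
      # (coloured? π H (suc i)) + # (Fin._≟ ends i)              ≡⟨ cong (# (coloured? π H (suc i)) +_) (trans (#-singleton (ends i)) (sym (count-suc i))) ⟩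
      # (coloured? π H (suc i)) + count suc (suc i)              ∎
      where
      open ≡-Reasoning
      pointwise : ∀ p → ι (h p Fin.≟ suc i) ≡ ι (coloured? π H (suc i) p) + ι (p Fin.≟ ends i)
      pointwise p = case p Fin.≟ ends i of λ
        { (yes refl) → trans (ι-yes (h p Fin.≟ suc i) (innermost-right lam i))
            (sym (cong₂ _+_ (ι-no (coloured? π H (suc i) p) λ (notEnd , _) → notEnd (i , refl))
                            (ι-yes (p Fin.≟ ends i) refl)))
        ; (no p≢end) → trans
            (ι-cong (h p Fin.≟ suc i) (coloured? π H (suc i) p)
              (λ hp≡i → innermost⇒colour i p hp≡i p≢end) (colour⇒innermost i p))
            (sym (trans (cong (ι (coloured? π H (suc i) p) +_) (ι-no (p Fin.≟ ends i) p≢end)) (+-identityʳ _))) }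

    lookup-composition : ∀ x → lookup (composition π H) x ≡ ℤ.+ # (coloured? π H x)
    lookup-composition x = trans (Vec.lookup∘tabulate (λ y → ℤ.+ length (filter (coloured? π H y) (allFin n))) x) (cong ℤ.+_ (length-filter-allFin (coloured? π H x)))

  -- From laminar families to valid hook configurations

  module _ {c} (c-admissible : Admissible Peak c) where

    -- From a descent d j, where π drops, one climbs by jumping to c j.
    climb : ∀ {r : Fin (#descents π) → Fin n} → (∀ i → c i Fin.≤ r i) → ∀ {x p : Fin n} → x Fin.< p →
      (∀ j → x Fin.≤ d j → d j Fin.< p → r j Fin.< p) → val x < val p
    climb {r} c≤r {x} {p} x<p skips = go x (Fin.>-wellFounded x) x<p skips
      where
      go : ∀ x → Acc Fin._>_ x → x Fin.< p → (∀ j → x Fin.≤ d j → d j Fin.< p → r j Fin.< p) → val x < val p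
      go x (acc rec) x<p skips with isDescent? π x
      ... | yes desc with d-surjective desc
      ...   | j , refl = <-trans (proj₁ (proj₁ c-admissible j))
        (go (c j) (rec dj<cj) (≤-<-trans (c≤r j) (skips j ≤-refl x<p))
          (λ i cj≤di → skips i (≤-trans (<⇒≤ dj<cj) cj≤di)))
        where dj<cj = IsLaminar.right (proj₂ c-admissible) j
      go x (acc rec) x<p skips | no ¬desc with m≤n⇒m<n∨m≡n x+1≤p
        where
        x+1≤p : suc (toℕ x) ≤ toℕ p
        x+1≤p = x<p
      ... | inj₂ x+1≡p = val-< (≮⇒≥ λ p<x → ¬desc (p , sym x+1≡p , p<x)) (λ x≡p → <-irrefl (cong toℕ x≡p) x<p)
      ... | inj₁ x+1<p = <-trans
          (val-< (≮⇒≥ λ y<x → ¬desc (y , y≡x+1 , y<x)) (λ x≡y → <-irrefl (cong toℕ x≡y) x<y))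
          (go y (rec x<y) (≤-trans (≤-reflexive (cong suc y≡x+1)) x+1<p) (λ i y≤di → skips i (≤-trans (<⇒≤ x<y) y≤di)))
        where
        x+1<n = <-trans x+1<p (Fin.toℕ<n p)
        y = Fin.fromℕ< x+1<n
        y≡x+1 : toℕ y ≡ suc (toℕ x)
        y≡x+1 = Fin.toℕ-fromℕ< x+1<n
        x<y : x Fin.< y
        x<y = ≤-reflexive (sym y≡x+1)

    -- Descents between a point `m` of the i-th interval and `r i` have intervals nested in it, so
    -- `climb` leads from `m` up to `r i`.
    vhc-of-laminar : ∀ r → IsLaminar r → (∀ i → c i Fin.≤ r i) → ∃ λ (H : VHC π) → ends H ≡ r
    vhc-of-laminar r r-laminar c≤r = record
      { hook = hooks
      ; startsAtDescent = λ _ → refl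
      ; noneAbove = λ i m (di<m , m<r , r<m) → <⇒≱ r<m (below i m di<m m<r)
      ; noCrossing = noCrossing } , refl
      where
      open IsLaminar r-laminar

      below-< : ∀ i m → d i Fin.< m → m Fin.< r i → val m < val (r i)
      below-< i m di<m m<r = climb c≤r m<r λ j m≤dj dj<r →
        nested (≰⇒> λ j≤i → <⇒≱ (<-≤-trans di<m m≤dj) (d-mono-≤ j≤i)) dj<r

      below : ∀ i m → d i Fin.< m → m Fin.< r i → val m ≤ val (r i)
      below i m di<m m<r = <⇒≤ (below-< i m di<m m<r)

      -- `climb` cannot start at `d i`, whose own interval ends only at `r i`; the first jump is
      -- made to `c i` instead.
      ascends : ∀ i → val (d i) < val (r i)
      ascends i with m≤n⇒m<n∨m≡n (c≤r i)
      ... | inj₁ c<r = <-trans (proj₁ (proj₁ c-admissible i)) (below-< i (c i) (IsLaminar.right (proj₂ c-admissible) i) c<r)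
      ... | inj₂ c≡r = <-≤-trans (proj₁ (proj₁ c-admissible i)) (≤-reflexive (cong val (Fin.toℕ-injective c≡r)))

      hooks : Fin (#descents π) → Hook π
      hooks i = record { sw = d i ; ne = r i ; sw<ne = right i ; rises = ascends i }

      noCrossing : ∀ i j → i ≢ j → ∀ p → OnHook π (hooks i) p → OnHook π (hooks j) p →
        (p ≡ plotPoint π (Hook.ne (hooks i)) × p ≡ plotPoint π (Hook.sw (hooks j))) ⊎
        (p ≡ plotPoint π (Hook.ne (hooks j)) × p ≡ plotPoint π (Hook.sw (hooks i)))
      noCrossing i j i≢j p on-i on-j = case Fin.<-cmp i j of λ
        { (tri< i<j _ _) → inj₁ (hooks-disjoint {hooks i} {hooks j} (d-mono i<j) (nested i<j) (below i) p on-i on-j)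
        ; (tri≈ _ i≡j _) → contradiction i≡j i≢j
        ; (tri> _ _ j<i) → inj₂ (hooks-disjoint {hooks j} {hooks i} (d-mono j<i) (nested j<i) (below j) p on-j on-i) }

-- Valid compositions as transversal sums

isMConvex-≐ : {A B : Pred (Vec ℤ k) 0ℓ} → A ≐ B → IsMConvex A → IsMConvex B
isMConvex-≐ (A⊆B , B⊆A) A-convex = record
  { nonempty = map₂ A⊆B nonempty
  ; exchange = λ a∈B b∈B i b<a → case exchange (B⊆A a∈B) (B⊆A b∈B) i b<a of λ
      (j , a<b , a∈ , b∈) → j , a<b , A⊆B a∈ , A⊆B b∈ }
  where
  open IsMConvex A-convex

module _ {n : ℕ} (π : Permutation n) where

  open Laminar (d π) (d-mono π)

  module _ {c : Fin (#descents π) → Fin n} (c-admissible : Admissible (Peak π) c)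
    (c-least : ∀ r → Admissible (Peak π) r → ∀ i → c i Fin.≤ r i) where

    open Assignments (proj₂ c-admissible)

    colours : Fin (length (complement c)) → Subset (suc (#descents π))
    colours q = tabulate λ x → does (allowed? x (free q))

    lookup-colours : ∀ x q → lookup (colours q) x ≡ does (allowed? x (free q))
    lookup-colours x q = Vec.lookup∘tabulate (λ y → does (allowed? y (free q))) x

    allowed⇒∈ : ∀ {x} q → Allowed x (free q) → x Subset.∈ colours q
    allowed⇒∈ {x} q al = Vec.lookup⇒[]= x (colours q)
      (trans (lookup-colours x q) (dec-true (allowed? x (free q)) al))

    ∈⇒allowed : ∀ {x} q → x Subset.∈ colours q → Allowed x (free q)
    ∈⇒allowed {x} q x∈ = does-true (allowed? x (free q)) (trans (sym (lookup-colours x q)) (Vec.[]=⇒lookup x∈))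

    -- Both the composition and the counts of `s` differ from the innermost counts by the same
    -- `count suc`, which cancels.
    composition-of-counts : ∀ H (s : Fin (length (complement c)) → Fin (suc (#descents π))) →
      (∀ x → count (innermost (ends π H)) x ≡ count s x + count suc x) →
      composition π H ≡ ∑ (λ q → e (s q))
    composition-of-counts H s counts = vec-ext λ x → trans (lookup-composition π H x)
      (trans (cong ℤ.+_ (+-cancelʳ-≡ (count suc x) _ _ (trans (sym (count-innermost π H x)) (counts x))))
             (sym (lookup-∑e s x)))

    transversal : validCompositions π ≐ transversalSums colours
    transversal = to , from
      where
      to : ∀ {q} → validCompositions π q → transversalSums colours q
      to (H , q≡) =
        let adm = ends-admissible π H
            s , allowed , counts = assignment-of-laminar (ends π H) (proj₂ adm) (c-least (ends π H) adm)
        in s , (λ q → allowed⇒∈ q (allowed q)) , trans q≡ (composition-of-counts H s counts)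

      from : ∀ {q} → transversalSums colours q → validCompositions π q
      from (s , s∈ , q≡) =
        let r , r-laminar , c≤r , counts = laminar-of-assignment s (λ q → ∈⇒allowed q (s∈ q))
            H , ends≡r = vhc-of-laminar π c-admissible r r-laminar c≤r
        in H , trans q≡ (sym (composition-of-counts H s λ x →
             trans (cong (λ r → count (innermost r) x) ends≡r) (counts x)))

    transversalDiscretePolymatroid : Satisfiable (validCompositions π) →
                                     IsTransversalDiscretePolymatroid (validCompositions π)
    transversalDiscretePolymatroid nonempty = record
      { isDiscretePolymatroid = record
        { isMConvex = isMConvex-≐ (proj₂ transversal , proj₁ transversal) (record
          { nonempty = map₂ (proj₁ transversal) nonempty
          ; exchange = transversalSums-exchange colours })
        ; finite = let xs , ⊆xs , xs⊆ = transversalSums-finite colours in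
            xs , ⊆xs ∘ proj₁ transversal , proj₂ transversal ∘ xs⊆
        ; nonnegative = λ (H , a≡) x → subst (ℤ.0ℤ ℤ.≤_)
            (sym (trans (cong (λ v → lookup v x) a≡) (lookup-composition π H x))) (ℤ.+≤+ z≤n) }
      ; ℓ = length (complement c)
      ; I = colours
      -- The smallest family `c` itself provides an allowed colour at each free point.
      ; I-nonempty = λ q → innermost c (free q) , allowed⇒∈ q (innermost-allowed c (λ _ → ≤-refl) (free q))
      ; isTransversal = transversal }

mainTheorem3 : ∀ (n : ℕ) (π : Permutation n) → Satisfiable (validCompositions π) →
    IsTransversalDiscretePolymatroid (validCompositions π)
mainTheorem3 n π nonempty@(_ , H , _) =
  -- The configuration that witnesses nonemptiness supplies the admissible family from which the
  -- least one is obtained.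
  let c , c-admissible , c-least = leastAdmissible (Peak π) (peak? π) (ends π H , ends-admissible π H)
  in transversalDiscretePolymatroid π c-admissible c-least nonempty
  where open Laminar (d π) (d-mono π)
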